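{- Let $f(x)\in\mathbf{Z}[x]$ be a separable polynomial of degree 2, and let $p$ be a good prime for $f(x)$. Then for every integer $m$ coprime to $p$ there exist infinitely many elements $d\in\mathcal{S}(f)$ such that $d\equiv m\pmod p$.
   Context: Squarefree integers may be negative and are nonzero. For a nonzero rational number $r$, its squarefree part $S(r)$ is the unique squarefree integer $d$ such that $r/d$ is a square in $\mathbf{Q}$. For a separable nonconstant $f(x)\in\mathbf{Z}[x]$, $\mathcal{S}(f)=\{S(f(r)) : r\in\mathbf{Q},\ f(r)\neq 0\}$. An odd prime $p$ is good for $f(x)$ if the reduced polynomial $\bar f(x)\in\mathbf{F}_p[x]$ has the same degree as $f(x)$ and has nonzero discriminant. -}

module Defs where

open import Algebra.Bundles using (RawRing)
import Algebra.Definitions.RawMonoid as RawMonoidDefinitions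
import Algebra.Definitions.RawSemiring as RawSemiringDefinitions
open import Data.Integer.Base as ℤ using (ℤ; +_; 0ℤ; 1ℤ; ∣_∣)
open import Data.Integer.Divisibility using (_∣_)
open import Data.List.Base using (List; []; _∷_; map)
open import Data.List.Membership.Propositional using (_∈_)
open import Data.Nat.Base as ℕ using (ℕ; zero; suc)
open import Data.Nat.Primality using (Prime)
open import Data.Product.Base using (∃-syntax; _×_)
open import Data.Rational.Base as ℚ using (ℚ; 0ℚ)
open import Level using (0ℓ)
open import Relation.Binary.PropositionalEquality.Core using (_≡_; _≢_)
open import Relation.Nullary.Negation.Core using (¬_)

-- Univariate polynomials as coefficient lists, constant term first.  Trailing
-- zeros are allowed, so polynomials are compared by coefficients with _≈ₚ_.
module Polynomial {c ℓ} (R : RawRing c ℓ) where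
  open RawRing R
  open RawMonoidDefinitions +-rawMonoid using () renaming (_×_ to _·_)

  Poly : Set c
  Poly = List Carrier

  coeff : Poly → ℕ → Carrier
  coeff []      _       = 0#
  coeff (a ∷ _) zero    = a
  coeff (_ ∷ f) (suc n) = coeff f n

  infix  4 _≈ₚ_
  infixl 6 _+ₚ_
  infixl 7 _*ₚ_

  _≈ₚ_ : Poly → Poly → Set ℓ
  f ≈ₚ g = ∀ n → coeff f n ≈ coeff g n

  _+ₚ_ : Poly → Poly → Poly
  []      +ₚ g       = g
  (a ∷ f) +ₚ []      = a ∷ f
  (a ∷ f) +ₚ (b ∷ g) = (a + b) ∷ (f +ₚ g)

  _*ₚ_ : Poly → Poly → Poly
  []      *ₚ g = []
  (a ∷ f) *ₚ g = map (a *_) g +ₚ (0# ∷ (f *ₚ g))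

  polyRing : RawRing c ℓ
  polyRing = record
    { Carrier = Poly
    ; _≈_     = _≈ₚ_
    ; _+_     = _+ₚ_
    ; _*_     = _*ₚ_
    ; -_      = map (-_)
    ; 0#      = []
    ; 1#      = 1# ∷ []
    }

  -- (a + x f)′ = f + x f′
  derivative : Poly → Poly
  derivative []      = []
  derivative (_ ∷ f) = f +ₚ (0# ∷ derivative f)

  eval : Poly → Carrier → Carrier
  eval []      x = 0#
  eval (a ∷ f) x = a + x * eval f x

  HasDegree : Poly → ℕ → Set ℓ
  HasDegree f n = coeff f n ≉ 0# × (∀ k → n ℕ.< k → coeff f k ≈ 0#)

  -- The discriminant b² - 4ac of a polynomial a x² + b x + c; meaningful only
  -- in degree 2.
  quadraticDiscriminant : Poly → Carrier
  quadraticDiscriminant f =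
    coeff f 1 * coeff f 1 + - (4 · (coeff f 2 * coeff f 0))

_≡_[mod_] : ℤ → ℤ → ℕ → Set
x ≡ y [mod p ] = + p ∣ x ℤ.- y

-- F_p, presented as ℤ with congruence modulo p as its equality.  Reduction of
-- an integer polynomial modulo p is then the identity on coefficient lists.
𝔽 : ℕ → RawRing 0ℓ 0ℓ
𝔽 p = record
  { Carrier = ℤ
  ; _≈_     = λ x y → x ≡ y [mod p ]
  ; _+_     = ℤ._+_
  ; _*_     = ℤ._*_
  ; -_      = ℤ.-_
  ; 0#      = 0ℤ
  ; 1#      = 1ℤ
  }

module ℤ[x] = Polynomial ℤ.+-*-rawRing
module ℚ[x] = Polynomial ℚ.+-*-rawRing
module 𝔽[x] (p : ℕ) = Polynomial (𝔽 p)

toℚ : ℤ → ℚ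
toℚ n = n ℚ./ 1

toℚ[x] : ℤ[x].Poly → ℚ[x].Poly
toℚ[x] = map toℚ

-- f and f′ have no nonconstant common factor in ℚ[x].
Separable : ℤ[x].Poly → Set
Separable f = Coprime (toℚ[x] f) (ℚ[x].derivative (toℚ[x] f))
  where
  open RawSemiringDefinitions (RawRing.rawSemiring ℚ[x].polyRing)
    using (Coprime)

-- Goodness of p for a polynomial f of degree 2.
record GoodQuadratic (p : ℕ) (f : ℤ[x].Poly) : Set where
  field
    prime        : Prime p
    odd          : p ≢ 2
    sameDegree   : ∀ n → ℤ[x].HasDegree f n → 𝔽[x].HasDegree p f n
    discriminant : ¬ (𝔽[x].quadraticDiscriminant p f ≡ 0ℤ [mod p ])

Squarefree : ℤ → Set
Squarefree d = d ≢ 0ℤ × (∀ k → k ℤ.* k ∣ d → ∣ k ∣ ≡ 1)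

-- d = S(r): the condition that r / d is the square of q is written without the
-- division, which is harmless because d ≢ 0.
IsSquarefreePart : ℚ → ℤ → Set
IsSquarefreePart r d = Squarefree d × ∃[ q ] r ≡ toℚ d ℚ.* (q ℚ.* q)

-- d ∈ 𝒮 f
𝒮 : ℤ[x].Poly → ℤ → Set
𝒮 f d = ∃[ r ] ℚ[x].eval (toℚ[x] f) r ≢ 0ℚ
             × IsSquarefreePart (ℚ[x].eval (toℚ[x] f) r) d

-- No finite list exhausts P.
Infinite : (ℤ → Set) → Set
Infinite P = ∀ (xs : List ℤ) → ∃[ d ] P d × ¬ (d ∈ xs)

module Submission where

-- Write D = b² - 4ac and a = d k² with d squarefree.  Then
-- f((u/y - b)/(2a)) = a (u² - D y²)/(2ay)², so d (u² - D y²) is in 𝒮 f as soon as it is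
-- squarefree.  By the pigeonhole principle d (i² - D j²) ≡ m (mod p) is solvable, and u, y
-- are taken in progressions that preserve this congruence and make u² - D y² prime to all
-- small numbers not divisible by p: u runs through an arithmetic progression of length N,
-- and y through T multiples of powers of the modulus, with T fixed and N large.
--
-- A sieve finds a squarefree value among these T N.  If q² divides the values at (u, y) and
-- (u′, y′), then it divides u y′ - u′ y or u y′ + u′ y.  For q below N/8 this gives at most
-- two u per y in each window of length q²; together these q spoil at most half of the
-- pairs.  For larger q it forces u y′ = u′ y, as both numbers are O(N) and q² is not; as the
-- pairs have distinct slopes, q spoils at most one of them, and there are only O(N) such q,
-- fewer than T N/2 for T large.

open import Defs
open import Data.Empty using (⊥; ⊥-elim)
open import Data.Fin.Base as Fin using (Fin; toℕ; splitAt)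
import Data.Fin.Properties as Fin
open import Data.Integer.Base as ℤ using (ℤ; +_; ∣_∣; 0ℤ; 1ℤ)
open import Data.Integer.Coprimality using (Coprime)
import Data.Integer.DivMod as ℤ
open import Data.Integer.Divisibility.Signed renaming (_∣_ to _∣ₛ_)
import Data.Integer.Properties as ℤ
import Data.Integer.Tactic.RingSolver as ℤR
open import Data.List.Base using ([]; _∷_; map)
open import Data.List.Membership.Propositional using (_∈_)
open import Data.List.Relation.Unary.All using ([]; _∷_)
open import Data.List.Relation.Unary.Any using (here; there)
open import Data.Nat.Base as ℕ using (ℕ; zero; suc; _≤_; _<_; NonZero; NonTrivial; z≤n; s≤s; z<s)
import Data.Nat.Coprimality as ℕ
open import Data.Nat.DivMod as ℕ using (_/_)
import Data.Nat.Divisibility as ℕ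
open import Data.Nat.GCD using (module Bézout)
open import Data.Nat.Induction using (<-rec)
open import Data.Nat.ListAction using (sum)
open import Data.Nat.Primality
open import Data.Nat.Primality.Factorisation using (factorise)
import Data.Nat.Properties as ℕ
import Data.Nat.Tactic.RingSolver as ℕR
open import Data.Product.Base using (∃-syntax; _×_; _,_; proj₁; proj₂)
open import Data.Rational.Base as ℚ using (0ℚ; 1ℚ)
import Data.Rational.Properties as ℚ
open import Data.Rational.Solver using (module +-*-Solver)
import Data.Rational.Unnormalised.Base as ℚᵘ
import Data.Rational.Unnormalised.Properties as ℚᵘ
open import Data.Sum.Base as Sum using (_⊎_; inj₁; inj₂)
open import Function.Base using (_∘_)
open import Relation.Binary.PropositionalEquality
open import Relation.Nullary using (¬_; Dec; yes; no; contradiction; _×-dec_)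

-- Finite sums of natural numbers

module Sums where
  open import Data.Nat.Base using (_+_; _*_; _∸_)
  open import Data.Nat.DivMod using (m/n*n≤m; m≡m%n+[m/n]*n; m%n<n)
  open import Data.Nat.Properties

  Σ< : ℕ → (ℕ → ℕ) → ℕ
  Σ< zero    f = 0
  Σ< (suc n) f = Σ< n f + f n

  indicator : ∀ {a} {A : Set a} → Dec A → ℕ
  indicator (yes _) = 1
  indicator (no _)  = 0

  indicator≤1 : ∀ {a} {A : Set a} (a? : Dec A) → indicator a? ≤ 1
  indicator≤1 (yes _) = ≤-refl
  indicator≤1 (no _)  = z≤n

  indicator>0⇒ : ∀ {a} {A : Set a} (a? : Dec A) → 0 < indicator a? → A
  indicator>0⇒ (yes a) _ = a

  indicator≡0⇒ : ∀ {a} {A : Set a} (a? : Dec A) → indicator a? ≡ 0 → ¬ A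
  indicator≡0⇒ (no ¬a) _ = ¬a

  ¬⇒indicator≡0 : ∀ {a} {A : Set a} (a? : Dec A) → ¬ A → indicator a? ≡ 0
  ¬⇒indicator≡0 (yes a) ¬a = contradiction a ¬a
  ¬⇒indicator≡0 (no _)  _  = refl

  Σ<-mono : ∀ n {f g : ℕ → ℕ} → (∀ {i} → i < n → f i ≤ g i) → Σ< n f ≤ Σ< n g
  Σ<-mono zero    f≤g = z≤n
  Σ<-mono (suc n) f≤g =
    +-mono-≤ (Σ<-mono n (λ i<n → f≤g (m<n⇒m<1+n i<n))) (f≤g ≤-refl)

  Σ<-cong : ∀ n {f g : ℕ → ℕ} → (∀ i → f i ≡ g i) → Σ< n f ≡ Σ< n g
  Σ<-cong zero    f≡g = refl
  Σ<-cong (suc n) f≡g = cong₂ _+_ (Σ<-cong n f≡g) (f≡g n)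

  Σ<-const : ∀ n c → Σ< n (λ _ → c) ≡ n * c
  Σ<-const zero    c = refl
  Σ<-const (suc n) c = trans (cong (_+ c) (Σ<-const n c)) (+-comm (n * c) c)

  Σ<-bounded : ∀ n {f : ℕ → ℕ} c → (∀ {i} → i < n → f i ≤ c) → Σ< n f ≤ n * c
  Σ<-bounded n {f} c f≤c = subst (Σ< n f ≤_) (Σ<-const n c) (Σ<-mono n f≤c)

  Σ<-+ : ∀ n (f g : ℕ → ℕ) → Σ< n (λ i → f i + g i) ≡ Σ< n f + Σ< n g
  Σ<-+ zero    f g = refl
  Σ<-+ (suc n) f g = trans (cong (_+ (f n + g n)) (Σ<-+ n f g)) (lemma (Σ< n f) (Σ< n g) (f n) (g n))
    where
    lemma : ∀ a b c d → (a + b) + (c + d) ≡ (a + c) + (b + d)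
    lemma = ℕR.solve-∀

  Σ<-swap : ∀ m n (f : ℕ → ℕ → ℕ) →
            Σ< m (λ i → Σ< n (f i)) ≡ Σ< n (λ j → Σ< m (λ i → f i j))
  Σ<-swap zero    n f = sym (trans (Σ<-const n 0) (*-zeroʳ n))
  Σ<-swap (suc m) n f =
    trans (cong (_+ Σ< n (f m)) (Σ<-swap m n f))
          (sym (Σ<-+ n (λ j → Σ< m (λ i → f i j)) (f m)))

  Σ<-split : ∀ m n (f : ℕ → ℕ) → Σ< (m + n) f ≡ Σ< m f + Σ< n (λ i → f (m + i))
  Σ<-split m zero    f = trans (cong (λ k → Σ< k f) (+-identityʳ m)) (sym (+-identityʳ _))
  Σ<-split m (suc n) f = begin
    Σ< (m + suc n) f                                 ≡⟨ cong (λ k → Σ< k f) (+-suc m n) ⟩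
    Σ< (m + n) f + f (m + n)                         ≡⟨ cong (_+ f (m + n)) (Σ<-split m n f) ⟩
    Σ< m f + Σ< n (λ i → f (m + i)) + f (m + n)      ≡⟨ +-assoc (Σ< m f) _ _ ⟩
    Σ< m f + (Σ< n (λ i → f (m + i)) + f (m + n))    ∎
    where open ≡-Reasoning

  Σ<-monoˡ : ∀ {m n} (f : ℕ → ℕ) → m ≤ n → Σ< m f ≤ Σ< n f
  Σ<-monoˡ {m} {n} f m≤n = begin
    Σ< m f                                     ≤⟨ m≤m+n _ _ ⟩
    Σ< m f + Σ< (n ∸ m) (λ i → f (m + i))      ≡⟨ Σ<-split m (n ∸ m) f ⟨
    Σ< (m + (n ∸ m)) f                         ≡⟨ cong (λ k → Σ< k f) (m+[n∸m]≡n m≤n) ⟩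
    Σ< n f                                     ∎
    where open ≤-Reasoning

  Σ<-≡0 : ∀ n {f : ℕ → ℕ} → (∀ {i} → i < n → f i ≡ 0) → Σ< n f ≡ 0
  Σ<-≡0 n {f} f≡0 =
    n≤0⇒n≡0 (subst (Σ< n f ≤_) (*-zeroʳ n) (Σ<-bounded n 0 (λ i<n → ≤-reflexive (f≡0 i<n))))

  term≤Σ< : ∀ n (f : ℕ → ℕ) {i} → i < n → f i ≤ Σ< n f
  term≤Σ< (suc n) f i<1+n with m<1+n⇒m<n∨m≡n i<1+n
  ... | inj₁ i<n  = ≤-trans (term≤Σ< n f i<n) (m≤m+n _ _)
  ... | inj₂ refl = m≤n+m _ _

  Σ<≡0⇒ : ∀ n {f : ℕ → ℕ} → Σ< n f ≡ 0 → ∀ {i} → i < n → f i ≡ 0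
  Σ<≡0⇒ (suc n) {f} Σ≡0 {i} i<1+n with m<1+n⇒m<n∨m≡n i<1+n
  ... | inj₁ i<n  = Σ<≡0⇒ n (m+n≡0⇒m≡0 (Σ< n f) Σ≡0) i<n
  ... | inj₂ refl = m+n≡0⇒n≡0 (Σ< n f) Σ≡0

  Σ<>0⇒ : ∀ n {f : ℕ → ℕ} → 0 < Σ< n f → ∃[ i ] i < n × 0 < f i
  Σ<>0⇒ (suc n) {f} Σ>0 with f n in eq
  ... | suc _ = n , ≤-refl , subst (0 <_) (sym eq) z<s
  ... | zero with i , i<n , fi>0 ← Σ<>0⇒ n (subst (0 <_) (+-identityʳ _) Σ>0)
    = i , m<n⇒m<1+n i<n , fi>0

  Σ<-least : ∀ n {f : ℕ → ℕ} c → Σ< n f < n * c → ∃[ i ] i < n × f i < c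
  Σ<-least (suc n) {f} c Σ<nc with f n <? c
  ... | yes fn<c = n , ≤-refl , fn<c
  ... | no  fn≮c
    = let i , i<n , fi<c = Σ<-least n c (+-cancelʳ-< c _ _ Σ+c<nc+c)
      in  i , m<n⇒m<1+n i<n , fi<c
    where
    open ≤-Reasoning
    Σ+c<nc+c : Σ< n f + c < n * c + c
    Σ+c<nc+c = begin-strict
      Σ< n f + c     ≤⟨ +-monoʳ-≤ (Σ< n f) (≮⇒≥ fn≮c) ⟩
      Σ< n f + f n   <⟨ Σ<nc ⟩
      c + n * c      ≡⟨ +-comm c (n * c) ⟩
      n * c + c      ∎

  infix 4 _OneOn_
  _OneOn_ : (ℕ → ℕ) → ℕ → Set
  f OneOn n = ∀ {i j} → i < j → j < n → 0 < f i → 0 < f j → ⊥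

  Σ<≤1 : ∀ n {f : ℕ → ℕ} → (∀ {i} → i < n → f i ≤ 1) → f OneOn n → Σ< n f ≤ 1
  Σ<≤1 zero        f≤1 one = z≤n
  Σ<≤1 (suc n) {f} f≤1 one with f n in eq
  ... | zero  = subst (_≤ 1) (sym (+-identityʳ _))
                  (Σ<≤1 n (f≤1 ∘ m<n⇒m<1+n) (λ i<j j<n → one i<j (m<n⇒m<1+n j<n)))
  ... | suc _ = subst (_≤ 1) (cong₂ _+_ (sym before≡0) eq) (f≤1 ≤-refl)
    where
    before≡0 : Σ< n f ≡ 0
    before≡0 = Σ<-≡0 n λ {i} i<n →
      n≤0⇒n≡0 (≮⇒≥ λ fi>0 → one i<n ≤-refl fi>0 (subst (0 <_) (sym eq) z<s))

  Σ<≤2 : ∀ n {f : ℕ → ℕ} → (∀ i → f i ≤ 1) →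
         (∀ {i j k} → i < j → j < k → k < n → 0 < f i → 0 < f j → 0 < f k → ⊥) →
         Σ< n f ≤ 2
  Σ<≤2 zero        f≤1 two = z≤n
  Σ<≤2 (suc n) {f} f≤1 two with f n in eq
  ... | zero  = subst (_≤ 2) (sym (+-identityʳ _))
                  (Σ<≤2 n f≤1 (λ i<j j<k k<n → two i<j j<k (m<n⇒m<1+n k<n)))
  ... | suc _ = +-mono-≤
      (Σ<≤1 n (λ _ → f≤1 _) (λ i<j j<n fi fj → two i<j j<n ≤-refl fi fj (subst (0 <_) (sym eq) z<s)))
      (subst (_≤ 1) eq (f≤1 n))

  Σ<-blocks : ∀ k w (f : ℕ → ℕ) c → (∀ x → Σ< w (λ i → f (x + i)) ≤ c) → Σ< (k * w) f ≤ k * c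
  Σ<-blocks zero    w f c f≤c = z≤n
  Σ<-blocks (suc k) w f c f≤c = begin
    Σ< (w + k * w) f                            ≡⟨ Σ<-split w (k * w) f ⟩
    Σ< w f + Σ< (k * w) (λ i → f (w + i))
      ≤⟨ +-mono-≤ (f≤c 0) (Σ<-blocks k w _ c λ x → subst (_≤ c)
           (Σ<-cong w (λ i → cong f (+-assoc w x i))) (f≤c (w + x))) ⟩
    c + k * c                                   ∎
    where open ≤-Reasoning

  Σ<-windows : ∀ n w .{{_ : NonZero w}} (f : ℕ → ℕ) c →
               (∀ x → Σ< w (λ i → f (x + i)) ≤ c) → Σ< n f ≤ suc (n / w) * c
  Σ<-windows n w f c f≤c =
    ≤-trans (Σ<-monoˡ f n≤) (Σ<-blocks (suc (n / w)) w f c f≤c)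
    where
    open ≤-Reasoning
    n≤ : n ≤ suc (n / w) * w
    n≤ = begin
      n                          ≡⟨ m≡m%n+[m/n]*n n w ⟩
      _ + n / w * w              ≤⟨ +-monoˡ-≤ (n / w * w) (<⇒≤ (m%n<n n w)) ⟩
      w + n / w * w              ∎

  -- The discrete form of Σ_{i≥0} 1/(z+1+i)² ≤ 1/z, with the telescoping terms
  -- n/(z(z+n)) = 1/z - 1/(z+n) cleared of denominators.
  Σ<-reciprocal-squares : ∀ N z n →
    z * (z + n) * Σ< n (λ i → N / (suc (z + i) * suc (z + i))) ≤ N * n
  Σ<-reciprocal-squares N z zero    = ≤-reflexive (trans (*-zeroʳ (z * (z + 0))) (sym (*-zeroʳ N)))
  Σ<-reciprocal-squares N zero    (suc n) = z≤n
  Σ<-reciprocal-squares N z@(suc _) (suc n) = *-cancelʳ-≤ _ _ (z + n) (begin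
    z * (z + suc n) * (S + x) * (z + n)
      ≡⟨ lemma₁ z n S x ⟩
    z * (z + n) * S * suc (z + n) + z * (x * (suc (z + n) * (z + n)))
      ≤⟨ +-mono-≤ (*-monoˡ-≤ (suc (z + n)) (Σ<-reciprocal-squares N z n))
                  (*-monoʳ-≤ z (≤-trans (*-monoʳ-≤ x (*-monoʳ-≤ (suc (z + n)) (n≤1+n (z + n))))
                                        (m/n*n≤m N (suc (z + n) * suc (z + n))))) ⟩
    N * n * suc (z + n) + z * N
      ≡⟨ lemma₂ N z n ⟩
    N * suc n * (z + n) ∎)
    where
    open ≤-Reasoning
    S = Σ< n (λ i → N / (suc (z + i) * suc (z + i)))
    x = N / (suc (z + n) * suc (z + n))
    lemma₁ : ∀ z n S x → z * (z + suc n) * (S + x) * (z + n) ≡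
             z * (z + n) * S * suc (z + n) + z * (x * (suc (z + n) * (z + n)))
    lemma₁ = ℕR.solve-∀
    lemma₂ : ∀ N z n → N * n * suc (z + n) + z * N ≡ N * suc n * (z + n)
    lemma₂ = ℕR.solve-∀

open Sums

-- Prime squares dividing values of u² - D y²

private variable
  q : ℕ

prime∣*⇒∣⊎∣ : Prime q → ∀ i j → + q ∣ₛ i ℤ.* j → + q ∣ₛ i ⊎ + q ∣ₛ j
prime∣*⇒∣⊎∣ {q} q-prime i j q∣ij =
  Sum.map ∣ᵤ⇒∣ ∣ᵤ⇒∣
    (euclidsLemma ∣ i ∣ ∣ j ∣ q-prime (subst (q ℕ.∣_) (ℤ.abs-* i j) (∣⇒∣ᵤ q∣ij)))

sq∣⇒∣ : ∀ {q i} → + (q ℕ.* q) ∣ₛ i → + q ∣ₛ i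
sq∣⇒∣ {q} = ∣-trans (∣ᵤ⇒∣ (ℕ.m∣m*n q))

prime∣i²⇒∣i : Prime q → ∀ i → + q ∣ₛ i ℤ.* i → + q ∣ₛ i
prime∣i²⇒∣i q-prime i q∣i² = Sum.reduce (prime∣*⇒∣⊎∣ q-prime i i q∣i²)

prime∤⇒sq∣*⇒sq∣ : Prime q → ∀ i {j} → ¬ + q ∣ₛ j → + (q ℕ.* q) ∣ₛ i ℤ.* j → + (q ℕ.* q) ∣ₛ i
prime∤⇒sq∣*⇒sq∣ {q} q-prime i {j} q∤j q²∣ij
  with prime∣*⇒∣⊎∣ q-prime i j (sq∣⇒∣ q²∣ij)
... | inj₂ q∣j = contradiction q∣j q∤j
... | inj₁ (divides k refl) =
  Sum.[ (λ q∣k → subst (_∣ₛ k ℤ.* + q) (sym (ℤ.pos-* q q)) (*-monoˡ-∣ (+ q) q∣k))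
      , (λ q∣j → contradiction q∣j q∤j)
      ]′ (prime∣*⇒∣⊎∣ q-prime k j
           (*-cancelʳ-∣ (+ q) (subst₂ _∣ₛ_ (ℤ.pos-* q q) (swap k (+ q) j) q²∣ij)))
  where
  instance _ = prime⇒nonZero q-prime
  swap : ∀ k q j → k ℤ.* q ℤ.* j ≡ k ℤ.* j ℤ.* q
  swap = ℤR.solve-∀

prime-sq∣*⇒∣⊎∣ : Prime q → ∀ i j → ¬ (+ q ∣ₛ i × + q ∣ₛ j) →
                 + (q ℕ.* q) ∣ₛ i ℤ.* j → + (q ℕ.* q) ∣ₛ i ⊎ + (q ℕ.* q) ∣ₛ j
prime-sq∣*⇒∣⊎∣ {q} q-prime i j ¬both q²∣ij with + q ∣? j
... | no  q∤j = inj₁ (prime∤⇒sq∣*⇒sq∣ q-prime i q∤j q²∣ij)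
... | yes q∣j = inj₂ (prime∤⇒sq∣*⇒sq∣ q-prime j (λ q∣i → ¬both (q∣i , q∣j))
                       (subst (+ (q ℕ.* q) ∣ₛ_) (ℤ.*-comm i j) q²∣ij))

∣∧∣∣<⇒≡0 : ∀ {m i} → + m ∣ₛ i → ∣ i ∣ < m → ∣ i ∣ ≡ 0
∣∧∣∣<⇒≡0 {m} {i} m∣i ∣i∣<m with ∣ i ∣ | ∣⇒∣ᵤ m∣i
... | zero  | _     = refl
... | suc k | m∣1+k = contradiction ∣i∣<m (ℕ.≤⇒≯ (ℕ.∣⇒≤ m∣1+k))

∣pos-pos∣≤⊔ : ∀ m n → ∣ + m ℤ.- + n ∣ ≤ m ℕ.⊔ n
∣pos-pos∣≤⊔ m n rewrite ℤ.m-n≡m⊖n m n = ℤ.∣m⊝n∣≤m⊔n m n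

∣-∧<⇒≡ : ∀ {k m n} → + k ∣ₛ + m ℤ.- + n → m < k → n < k → m ≡ n
∣-∧<⇒≡ {k} {m} {n} k∣m-n m<k n<k =
  ℤ.+-injective (ℤ.i-j≡0⇒i≡j (+ m) (+ n) (ℤ.∣i∣≡0⇒i≡0
    (∣∧∣∣<⇒≡0 k∣m-n (ℕ.≤-<-trans (∣pos-pos∣≤⊔ m n) (ℕ.⊔-lub m<k n<k)))))

norm : ℤ → ℕ → ℕ → ℤ
norm D u y = + u ℤ.* + u ℤ.- D ℤ.* (+ y ℤ.* + y)

norm-cross : ∀ D u y u′ y′ →
  (+ (u ℕ.* y′) ℤ.- + (u′ ℕ.* y)) ℤ.* (+ (u ℕ.* y′) ℤ.+ + (u′ ℕ.* y)) ≡
  norm D u y ℤ.* (+ y′ ℤ.* + y′) ℤ.- norm D u′ y′ ℤ.* (+ y ℤ.* + y)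
norm-cross D u y u′ y′ =
  trans (cong₂ (λ a b → (a ℤ.- b) ℤ.* (a ℤ.+ b)) (ℤ.pos-* u y′) (ℤ.pos-* u′ y))
        (lemma D (+ u) (+ y) (+ u′) (+ y′))
  where
  lemma : ∀ D u y u′ y′ →
    (u ℤ.* y′ ℤ.- u′ ℤ.* y) ℤ.* (u ℤ.* y′ ℤ.+ u′ ℤ.* y) ≡
    (u ℤ.* u ℤ.- D ℤ.* (y ℤ.* y)) ℤ.* (y′ ℤ.* y′) ℤ.-
    (u′ ℤ.* u′ ℤ.- D ℤ.* (y′ ℤ.* y′)) ℤ.* (y ℤ.* y)
  lemma = ℤR.solve-∀

-- q² divides (u y′ - u′ y)(u y′ + u′ y), and q cannot divide both factors.
sq∣norms⇒ : ∀ {D q} → Prime q → ¬ + q ∣ₛ + 2 → ¬ + q ∣ₛ D → ∀ u y u′ y′ →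
            ¬ + q ∣ₛ + y → ¬ + q ∣ₛ + y′ →
            + (q ℕ.* q) ∣ₛ norm D u y → + (q ℕ.* q) ∣ₛ norm D u′ y′ →
            + (q ℕ.* q) ∣ₛ + (u ℕ.* y′) ℤ.- + (u′ ℕ.* y) ⊎
            + (q ℕ.* q) ∣ₛ + (u ℕ.* y′) ℤ.+ + (u′ ℕ.* y)
sq∣norms⇒ {D} {q} q-prime q∤2 q∤D u y u′ y′ q∤y q∤y′ q²∣n q²∣n′ =
  prime-sq∣*⇒∣⊎∣ q-prime _ _ ¬both
    (subst (+ (q ℕ.* q) ∣ₛ_) (sym (norm-cross D u y u′ y′))
      (∣m∣n⇒∣m-n (∣m⇒∣m*n _ q²∣n) (∣m⇒∣m*n _ q²∣n′)))
  where
  restore : ∀ a b → a ℤ.- (a ℤ.- b) ≡ b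
  restore = ℤR.solve-∀

  q∤u : ¬ + q ∣ₛ + u
  q∤u q∣u = Sum.[ q∤D , (λ q∣y² → q∤y (prime∣i²⇒∣i q-prime (+ y) q∣y²)) ]′
    (prime∣*⇒∣⊎∣ q-prime D _ (subst (+ q ∣ₛ_) (restore (+ u ℤ.* + u) _)
      (∣m∣n⇒∣m-n (∣m⇒∣m*n (+ u) q∣u) (sq∣⇒∣ q²∣n))))

  double : ∀ a b → (a ℤ.- b) ℤ.+ (a ℤ.+ b) ≡ + 2 ℤ.* a
  double = ℤR.solve-∀

  ¬both : ¬ (+ q ∣ₛ + (u ℕ.* y′) ℤ.- + (u′ ℕ.* y) × + q ∣ₛ + (u ℕ.* y′) ℤ.+ + (u′ ℕ.* y))
  ¬both (q∣- , q∣+) = Sum.[ q∤2 , (λ q∣uy′ → Sum.[ q∤u , q∤y′ ]′ (prime∣*⇒∣⊎∣ q-prime (+ u) (+ y′) q∣uy′)) ]′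
    (prime∣*⇒∣⊎∣ q-prime (+ 2) _
      (subst (+ q ∣ₛ_) (trans (double (+ (u ℕ.* y′)) (+ (u′ ℕ.* y))) (cong (+ 2 ℤ.*_) (ℤ.pos-* u y′)))
        (∣m∣n⇒∣m+n q∣- q∣+)))

norm-bound : ∀ D u y → ∣ norm D u y ∣ ≤ u ℕ.* u ℕ.+ ∣ D ∣ ℕ.* (y ℕ.* y)
norm-bound D u y = begin
  ∣ + u ℤ.* + u ℤ.- D ℤ.* (+ y ℤ.* + y) ∣
    ≤⟨ ℤ.∣i-j∣≤∣i∣+∣j∣ (+ u ℤ.* + u) _ ⟩
  ∣ + u ℤ.* + u ∣ ℕ.+ ∣ D ℤ.* (+ y ℤ.* + y) ∣
    ≡⟨ cong₂ ℕ._+_ (ℤ.abs-* (+ u) (+ u))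
         (trans (ℤ.abs-* D _) (cong (∣ D ∣ ℕ.*_) (ℤ.abs-* (+ y) (+ y)))) ⟩
  u ℕ.* u ℕ.+ ∣ D ∣ ℕ.* (y ℕ.* y) ∎
  where open ℕ.≤-Reasoning

sq≤∣norm∣+ : ∀ D u y → u ℕ.* u ≤ ∣ norm D u y ∣ ℕ.+ ∣ D ∣ ℕ.* (y ℕ.* y)
sq≤∣norm∣+ D u y = begin
  u ℕ.* u                                           ≡⟨ ℤ.abs-* (+ u) (+ u) ⟨
  ∣ + u ℤ.* + u ∣                                   ≡⟨ cong ∣_∣ (restore (+ u ℤ.* + u) _) ⟨
  ∣ norm D u y ℤ.+ D ℤ.* (+ y ℤ.* + y) ∣            ≤⟨ ℤ.∣i+j∣≤∣i∣+∣j∣ (norm D u y) _ ⟩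
  ∣ norm D u y ∣ ℕ.+ ∣ D ℤ.* (+ y ℤ.* + y) ∣
    ≡⟨ cong (∣ norm D u y ∣ ℕ.+_)
         (trans (ℤ.abs-* D _) (cong (∣ D ∣ ℕ.*_) (ℤ.abs-* (+ y) (+ y)))) ⟩
  ∣ norm D u y ∣ ℕ.+ ∣ D ∣ ℕ.* (y ℕ.* y)            ∎
  where
  open ℕ.≤-Reasoning
  restore : ∀ a b → (a ℤ.- b) ℤ.+ b ≡ a
  restore = ℤR.solve-∀

-- The sieve

module SquarefreeNorms
  (D : ℤ) (u₀ c z X : ℕ) .{{c≢0 : NonZero c}} (y : ℕ → ℕ)
  (8≤z : 8 ≤ z)
  (generic : ∀ s j {q} → Prime q → + q ∣ₛ norm D (u₀ ℕ.+ c ℕ.* s) (y j) →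
             z < q × ¬ + q ∣ₛ + 2 × ¬ + q ∣ₛ D × ¬ + q ∣ₛ + c × ¬ + q ∣ₛ + y j)
  (slopes : ∀ s s′ {j j′} → j < j′ →
            (u₀ ℕ.+ c ℕ.* s) ℕ.* y j′ ≢ (u₀ ℕ.+ c ℕ.* s′) ℕ.* y j)
  where

  -- K makes |D| y² + X < u², whence X < |E| < (2u)²; n makes u y′ + u′ y < Q²; B bounds the
  -- primes whose square divides some E, and T makes B < 4 Q T, half the number of pairs.
  T Y K n Q N B : ℕ
  T = suc (4 ℕ.* suc c)
  Y = Σ< T y
  K = ∣ D ∣ ℕ.* (Y ℕ.* Y) ℕ.+ suc X

  u : ℕ → ℕ
  u s = u₀ ℕ.+ c ℕ.* (K ℕ.+ s)

  n = u 0 ℕ.+ 16 ℕ.* (suc c ℕ.* Y)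
  Q = suc z ℕ.+ n
  N = 8 ℕ.* Q
  B = 2 ℕ.* (suc c ℕ.* N)

  E : ℕ → ℕ → ℤ
  E j s = norm D (u s) (y j)

  Bad : ℕ → ℕ → ℕ → Set
  Bad j s q = Prime q × + (q ℕ.* q) ∣ₛ E j s

  bad? : ∀ j s q → Dec (Bad j s q)
  bad? j s q = prime? q ×-dec (+ (q ℕ.* q) ∣? E j s)

  bad : ℕ → ℕ → ℕ → ℕ
  bad j s q = indicator (bad? j s q)

  y≤Y : ∀ {j} → j < T → y j ≤ Y
  y≤Y = term≤Σ< T y

  K≤u : ∀ s → K ≤ u s
  K≤u s = begin
    K                            ≤⟨ ℕ.m≤m+n K s ⟩
    K ℕ.+ s                      ≤⟨ ℕ.m≤n*m (K ℕ.+ s) c ⟩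
    c ℕ.* (K ℕ.+ s)              ≤⟨ ℕ.m≤n+m _ u₀ ⟩
    u s                          ∎
    where open ℕ.≤-Reasoning

  u≤ : ∀ {s} → s < N → u s ≤ suc c ℕ.* N
  u≤ {s} s<N = begin
    u₀ ℕ.+ c ℕ.* (K ℕ.+ s)       ≡⟨ lemma u₀ c K s ⟩
    u 0 ℕ.+ c ℕ.* s              ≤⟨ ℕ.+-mono-≤ u0≤N (ℕ.*-monoʳ-≤ c (ℕ.<⇒≤ s<N)) ⟩
    N ℕ.+ c ℕ.* N                ∎
    where
    open ℕ.≤-Reasoning
    lemma : ∀ a c K s → a ℕ.+ c ℕ.* (K ℕ.+ s) ≡ a ℕ.+ c ℕ.* (K ℕ.+ 0) ℕ.+ c ℕ.* s
    lemma = ℕR.solve-∀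
    u0≤N : u 0 ≤ N
    u0≤N = begin
      u 0       ≤⟨ ℕ.m≤m+n (u 0) _ ⟩
      n         ≤⟨ ℕ.m≤n+m n (suc z) ⟩
      Q         ≤⟨ ℕ.m≤n*m Q 8 ⟩
      N         ∎

  Dy²+X<u² : ∀ {j} → j < T → ∀ s → ∣ D ∣ ℕ.* (y j ℕ.* y j) ℕ.+ suc X ≤ u s ℕ.* u s
  Dy²+X<u² {j} j<T s = begin
    ∣ D ∣ ℕ.* (y j ℕ.* y j) ℕ.+ suc X
      ≤⟨ ℕ.+-monoˡ-≤ (suc X) (ℕ.*-monoʳ-≤ ∣ D ∣ (ℕ.*-mono-≤ (y≤Y j<T) (y≤Y j<T))) ⟩
    K              ≤⟨ K≤u s ⟩
    u s            ≤⟨ ℕ.m≤n*m (u s) (u s) {{ℕ.>-nonZero u>0}} ⟩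
    u s ℕ.* u s    ∎
    where
    open ℕ.≤-Reasoning
    u>0 : 0 < u s
    u>0 = ℕ.<-≤-trans (ℕ.<-≤-trans z<s (ℕ.m≤n+m (suc X) _)) (K≤u s)

  X<∣E∣ : ∀ {j} → j < T → ∀ s → X < ∣ E j s ∣
  X<∣E∣ {j} j<T s = ℕ.+-cancelʳ-≤ (∣ D ∣ ℕ.* (y j ℕ.* y j)) (suc X) ∣ E j s ∣ (begin
    suc X ℕ.+ ∣ D ∣ ℕ.* (y j ℕ.* y j)      ≡⟨ ℕ.+-comm (suc X) _ ⟩
    ∣ D ∣ ℕ.* (y j ℕ.* y j) ℕ.+ suc X      ≤⟨ Dy²+X<u² j<T s ⟩
    u s ℕ.* u s                            ≤⟨ sq≤∣norm∣+ D (u s) (y j) ⟩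
    ∣ E j s ∣ ℕ.+ ∣ D ∣ ℕ.* (y j ℕ.* y j)  ∎)
    where open ℕ.≤-Reasoning

  bad⇒<B : ∀ {j s q} → j < T → s < N → Bad j s q → q < B
  bad⇒<B {j} {s} {q} j<T s<N (_ , q²∣E) =
    ℕ.<-≤-trans (ℕ.≰⇒> 2u≰q) (ℕ.*-monoʳ-≤ 2 (u≤ s<N))
    where
    open ℕ.≤-Reasoning
    lemma : ∀ a → a ℕ.* a ℕ.+ a ℕ.* a ≤ (2 ℕ.* a) ℕ.* (2 ℕ.* a)
    lemma a = subst (a ℕ.* a ℕ.+ a ℕ.* a ≤_) (sym (four a)) (ℕ.m≤m+n _ _)
      where
      four : ∀ a → (2 ℕ.* a) ℕ.* (2 ℕ.* a) ≡ a ℕ.* a ℕ.+ a ℕ.* a ℕ.+ (a ℕ.* a ℕ.+ a ℕ.* a)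
      four = ℕR.solve-∀
    E>0 : 0 < ∣ E j s ∣
    E>0 = ℕ.≤-<-trans z≤n (X<∣E∣ j<T s)
    2u≰q : ¬ 2 ℕ.* u s ≤ q
    2u≰q 2u≤q = ℕ.<-irrefl refl (begin-strict
      ∣ E j s ∣                                   ≤⟨ norm-bound D (u s) (y j) ⟩
      u s ℕ.* u s ℕ.+ ∣ D ∣ ℕ.* (y j ℕ.* y j)
        <⟨ ℕ.+-monoʳ-< (u s ℕ.* u s) (ℕ.<-≤-trans (ℕ.m<m+n _ z<s) (Dy²+X<u² j<T s)) ⟩
      u s ℕ.* u s ℕ.+ u s ℕ.* u s                 ≤⟨ lemma (u s) ⟩
      (2 ℕ.* u s) ℕ.* (2 ℕ.* u s)                 ≤⟨ ℕ.*-mono-≤ 2u≤q 2u≤q ⟩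
      q ℕ.* q                                     ≤⟨ ℕ.∣⇒≤ {{ℕ.>-nonZero E>0}} (∣⇒∣ᵤ q²∣E) ⟩
      ∣ E j s ∣                                   ∎)

  bad⇒generic : ∀ {j s q} → Bad j s q →
    z < q × ¬ + q ∣ₛ + 2 × ¬ + q ∣ₛ D × ¬ + q ∣ₛ + c × ¬ + q ∣ₛ + y j
  bad⇒generic {j} {s} (q-prime , q²∣E) = generic (K ℕ.+ s) j q-prime (sq∣⇒∣ q²∣E)

  bad⇒sq∣ : ∀ {j s j′ s′ q} → Bad j s q → Bad j′ s′ q →
            + (q ℕ.* q) ∣ₛ + (u s ℕ.* y j′) ℤ.- + (u s′ ℕ.* y j) ⊎
            + (q ℕ.* q) ∣ₛ + (u s ℕ.* y j′) ℤ.+ + (u s′ ℕ.* y j)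
  bad⇒sq∣ {j} {s} {j′} {s′} b@(q-prime , q²∣E) b′@(_ , q²∣E′) =
    let _ , q∤2 , q∤D , _ , q∤y = bad⇒generic {j} {s} b
        _ , _ , _ , _ , q∤y′    = bad⇒generic {j′} {s′} b′
    in  sq∣norms⇒ q-prime q∤2 q∤D (u s) (y j) (u s′) (y j′) q∤y q∤y′ q²∣E q²∣E′

  u-cancel : ∀ {s s′} → u s ≡ u s′ → s ≡ s′
  u-cancel {s} {s′} = ℕ.+-cancelˡ-≡ K s s′ ∘ ℕ.*-cancelˡ-≡ _ _ c ∘ ℕ.+-cancelˡ-≡ u₀ _ _

  u-diff : ∀ s s′ → + u s ℤ.- + u s′ ≡ (+ s ℤ.- + s′) ℤ.* + c
  u-diff s s′ = trans (cong₂ ℤ._-_ (pos-u s) (pos-u s′)) (lemma (+ u₀) (+ c) (+ K) (+ s) (+ s′))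
    where
    pos-u : ∀ s → + u s ≡ + u₀ ℤ.+ + c ℤ.* (+ K ℤ.+ + s)
    pos-u s = cong (λ a → + u₀ ℤ.+ a) (ℤ.pos-* c (K ℕ.+ s))
    lemma : ∀ a c K s s′ → (a ℤ.+ c ℤ.* (K ℤ.+ s)) ℤ.- (a ℤ.+ c ℤ.* (K ℤ.+ s′)) ≡ (s ℤ.- s′) ℤ.* c
    lemma = ℤR.solve-∀

  bad⇒sq∣same-y : ∀ {j s s′ q} → Bad j s q → Bad j s′ q →
                  + (q ℕ.* q) ∣ₛ + s ℤ.- + s′ ⊎ + (q ℕ.* q) ∣ₛ + u s ℤ.+ + u s′
  bad⇒sq∣same-y {j} {s} {s′} {q} b@(q-prime , _) b′ = Sum.map minus plus (bad⇒sq∣ b b′)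
    where
    g = bad⇒generic {j} {s} b
    q∤c : ¬ + q ∣ₛ + c
    q∤c = let _ , _ , _ , q∤c , _ = g in q∤c
    q∤y : ¬ + q ∣ₛ + y j
    q∤y = let _ , _ , _ , _ , q∤y = g in q∤y
    factor- : + (u s ℕ.* y j) ℤ.- + (u s′ ℕ.* y j) ≡ (+ u s ℤ.- + u s′) ℤ.* + y j
    factor- = trans (cong₂ ℤ._-_ (ℤ.pos-* (u s) (y j)) (ℤ.pos-* (u s′) (y j)))
                    (lemma (+ u s) (+ u s′) (+ y j))
      where
      lemma : ∀ a b c → a ℤ.* c ℤ.- b ℤ.* c ≡ (a ℤ.- b) ℤ.* c
      lemma = ℤR.solve-∀
    factor+ : + (u s ℕ.* y j) ℤ.+ + (u s′ ℕ.* y j) ≡ (+ u s ℤ.+ + u s′) ℤ.* + y j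
    factor+ = trans (cong₂ ℤ._+_ (ℤ.pos-* (u s) (y j)) (ℤ.pos-* (u s′) (y j)))
                    (sym (ℤ.*-distribʳ-+ (+ y j) (+ u s) (+ u s′)))
    minus : + (q ℕ.* q) ∣ₛ + (u s ℕ.* y j) ℤ.- + (u s′ ℕ.* y j) → + (q ℕ.* q) ∣ₛ + s ℤ.- + s′
    minus = prime∤⇒sq∣*⇒sq∣ q-prime (+ s ℤ.- + s′) q∤c
          ∘ subst (+ (q ℕ.* q) ∣ₛ_) (u-diff s s′)
          ∘ prime∤⇒sq∣*⇒sq∣ q-prime (+ u s ℤ.- + u s′) q∤y
          ∘ subst (+ (q ℕ.* q) ∣ₛ_) factor-
    plus : + (q ℕ.* q) ∣ₛ + (u s ℕ.* y j) ℤ.+ + (u s′ ℕ.* y j) → + (q ℕ.* q) ∣ₛ + u s ℤ.+ + u s′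
    plus = prime∤⇒sq∣*⇒sq∣ q-prime (+ u s ℤ.+ + u s′) q∤y
         ∘ subst (+ (q ℕ.* q) ∣ₛ_) factor+

  -- Of two roots s < s′ in a window of length q², the values u s and u s′ are
  -- opposite modulo q²; three roots cannot be pairwise opposite.
  window≤2 : ∀ j q x → Σ< (q ℕ.* q) (λ i → bad j (x ℕ.+ i) q) ≤ 2
  window≤2 j q x = Σ<≤2 (q ℕ.* q) (λ i → indicator≤1 (bad? j (x ℕ.+ i) q)) three
    where
    window-distinct : ∀ {i i′} → i < i′ → i′ < q ℕ.* q →
                      ¬ + (q ℕ.* q) ∣ₛ + (x ℕ.+ i) ℤ.- + (x ℕ.+ i′)
    window-distinct {i} {i′} i<i′ i′<q² q²∣ =
      ℕ.<⇒≢ i<i′ (∣-∧<⇒≡ (subst (+ (q ℕ.* q) ∣ₛ_) (lemma (+ x) (+ i) (+ i′)) q²∣)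
        (ℕ.<-trans i<i′ i′<q²) i′<q²)
      where
      lemma : ∀ x i i′ → (x ℤ.+ i) ℤ.- (x ℤ.+ i′) ≡ i ℤ.- i′
      lemma = ℤR.solve-∀

    opposite : ∀ {i i′} → i < i′ → i′ < q ℕ.* q → Bad j (x ℕ.+ i) q → Bad j (x ℕ.+ i′) q →
               + (q ℕ.* q) ∣ₛ + u (x ℕ.+ i) ℤ.+ + u (x ℕ.+ i′)
    opposite i<i′ i′<q² b b′ =
      Sum.[ ⊥-elim ∘ window-distinct i<i′ i′<q² , (λ q²∣+ → q²∣+) ]′ (bad⇒sq∣same-y b b′)

    three : ∀ {i i′ i″} → i < i′ → i′ < i″ → i″ < q ℕ.* q →
            0 < bad j (x ℕ.+ i) q → 0 < bad j (x ℕ.+ i′) q → 0 < bad j (x ℕ.+ i″) q → ⊥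
    three {i} {i′} {i″} i<i′ i′<i″ i″<q² pos pos′ pos″ =
      window-distinct i<i″ i″<q²
        (prime∤⇒sq∣*⇒sq∣ (proj₁ b) (+ (x ℕ.+ i) ℤ.- + (x ℕ.+ i″)) q∤c
          (subst (+ (q ℕ.* q) ∣ₛ_)
            (trans (lemma (+ u (x ℕ.+ i)) (+ u (x ℕ.+ i′)) (+ u (x ℕ.+ i″)))
                   (u-diff (x ℕ.+ i) (x ℕ.+ i″)))
            (∣m∣n⇒∣m-n (opposite i<i′ (ℕ.<-trans i′<i″ i″<q²) b b′) (opposite i′<i″ i″<q² b′ b″))))
      where
      i<i″ = ℕ.<-trans i<i′ i′<i″
      b  = indicator>0⇒ (bad? j (x ℕ.+ i) q) pos
      b′ = indicator>0⇒ (bad? j (x ℕ.+ i′) q) pos′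
      b″ = indicator>0⇒ (bad? j (x ℕ.+ i″) q) pos″
      q∤c : ¬ + q ∣ₛ + c
      q∤c = let _ , _ , _ , q∤c , _ = bad⇒generic {j} {x ℕ.+ i} b in q∤c
      lemma : ∀ a b c → (a ℤ.+ b) ℤ.- (b ℤ.+ c) ≡ a ℤ.- c
      lemma = ℤR.solve-∀

  tiny-q : ∀ j s → Σ< (suc z) (bad j s) ≡ 0
  tiny-q j s = Σ<-≡0 (suc z) λ {q} q<1+z →
    ¬⇒indicator≡0 (bad? j s q) λ b →
      ℕ.<⇒≱ (proj₁ (bad⇒generic {j} {s} b)) (ℕ.≤-pred q<1+z)

  recips : ℕ
  recips = Σ< n (λ i → N / (suc (z ℕ.+ i) ℕ.* suc (z ℕ.+ i)))

  recips≤Q : recips ≤ Q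
  recips≤Q = ℕ.*-cancelˡ-≤ 8 (begin
    8 ℕ.* recips      ≤⟨ ℕ.*-monoˡ-≤ recips 8≤z ⟩
    z ℕ.* recips      ≤⟨ ℕ.*-cancelʳ-≤ _ _ (z ℕ.+ n) {{ℕ.>-nonZero z+n>0}} z*recips*[z+n]≤ ⟩
    8 ℕ.* Q           ∎)
    where
    open ℕ.≤-Reasoning
    z+n>0 : 0 < z ℕ.+ n
    z+n>0 = ℕ.<-≤-trans z<s (ℕ.≤-trans 8≤z (ℕ.m≤m+n z n))
    lemma : ∀ a b c → a ℕ.* b ℕ.* c ≡ a ℕ.* c ℕ.* b
    lemma = ℕR.solve-∀
    z*recips*[z+n]≤ : z ℕ.* recips ℕ.* (z ℕ.+ n) ≤ N ℕ.* (z ℕ.+ n)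
    z*recips*[z+n]≤ = begin
      z ℕ.* recips ℕ.* (z ℕ.+ n)    ≡⟨ lemma z recips (z ℕ.+ n) ⟩
      z ℕ.* (z ℕ.+ n) ℕ.* recips    ≤⟨ Σ<-reciprocal-squares N z n ⟩
      N ℕ.* n                       ≤⟨ ℕ.*-monoʳ-≤ N (ℕ.m≤n+m n z) ⟩
      N ℕ.* (z ℕ.+ n)               ∎

  small-q : ∀ j → Σ< N (λ s → Σ< Q (bad j s)) ≤ 4 ℕ.* Q
  small-q j = begin
    Σ< N (λ s → Σ< Q (bad j s))
      ≡⟨ Σ<-cong N (λ s → trans (Σ<-split (suc z) n (bad j s))
           (cong (ℕ._+ Σ< n (λ i → bad j s (suc z ℕ.+ i))) (tiny-q j s))) ⟩
    Σ< N (λ s → Σ< n (λ i → bad j s (suc z ℕ.+ i)))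
      ≡⟨ Σ<-swap N n (λ s i → bad j s (suc z ℕ.+ i)) ⟩
    Σ< n (λ i → Σ< N (λ s → bad j s (suc z ℕ.+ i)))
      ≤⟨ Σ<-mono n (λ {i} _ → Σ<-windows N (suc (z ℕ.+ i) ℕ.* suc (z ℕ.+ i))
           (λ s → bad j s (suc (z ℕ.+ i))) 2 (window≤2 j (suc (z ℕ.+ i)))) ⟩
    Σ< n (λ i → suc (r i) ℕ.* 2)
      ≡⟨ Σ<-cong n (λ i → double (r i)) ⟩
    Σ< n (λ i → 2 ℕ.+ r i ℕ.+ r i)
      ≡⟨ trans (Σ<-+ n (λ i → 2 ℕ.+ r i) r)
           (cong (ℕ._+ recips) (trans (Σ<-+ n (λ _ → 2) r) (cong (ℕ._+ recips) (Σ<-const n 2)))) ⟩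
    n ℕ.* 2 ℕ.+ recips ℕ.+ recips
      ≤⟨ ℕ.+-mono-≤ (ℕ.+-mono-≤ (ℕ.*-monoˡ-≤ 2 (ℕ.m≤n+m n (suc z))) recips≤Q) recips≤Q ⟩
    Q ℕ.* 2 ℕ.+ Q ℕ.+ Q
      ≡⟨ four Q ⟩
    4 ℕ.* Q ∎
    where
    open ℕ.≤-Reasoning
    r : ℕ → ℕ
    r i = N / (suc (z ℕ.+ i) ℕ.* suc (z ℕ.+ i))
    double : ∀ a → suc a ℕ.* 2 ≡ 2 ℕ.+ a ℕ.+ a
    double = ℕR.solve-∀
    four : ∀ a → a ℕ.* 2 ℕ.+ a ℕ.+ a ≡ 4 ℕ.* a
    four = ℕR.solve-∀

  uy+uy<q² : ∀ {j j′ s s′ q} → j < T → j′ < T → s < N → s′ < N → Q ≤ q →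
             u s ℕ.* y j′ ℕ.+ u s′ ℕ.* y j < q ℕ.* q
  uy+uy<q² {j} {j′} {s} {s′} {q} j<T j′<T s<N s′<N Q≤q = begin-strict
    u s ℕ.* y j′ ℕ.+ u s′ ℕ.* y j
      ≤⟨ ℕ.+-mono-≤ (ℕ.*-mono-≤ (u≤ s<N) (y≤Y j′<T)) (ℕ.*-mono-≤ (u≤ s′<N) (y≤Y j<T)) ⟩
    suc c ℕ.* N ℕ.* Y ℕ.+ suc c ℕ.* N ℕ.* Y
      ≡⟨ lemma (suc c) Q Y ⟩
    16 ℕ.* (suc c ℕ.* Y) ℕ.* Q
      <⟨ ℕ.*-monoˡ-< Q (ℕ.≤-<-trans (ℕ.m≤n+m _ (u 0)) (ℕ.m<n+m n {suc z} z<s)) ⟩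
    Q ℕ.* Q
      ≤⟨ ℕ.*-mono-≤ Q≤q Q≤q ⟩
    q ℕ.* q ∎
    where
    open ℕ.≤-Reasoning
    lemma : ∀ c Q Y → c ℕ.* (8 ℕ.* Q) ℕ.* Y ℕ.+ c ℕ.* (8 ℕ.* Q) ℕ.* Y ≡ 16 ℕ.* (c ℕ.* Y) ℕ.* Q
    lemma = ℕR.solve-∀

  large-q⇒proportional : ∀ {j j′ s s′ q} → j < T → j′ < T → s < N → s′ < N → Q ≤ q →
                         Bad j s q → Bad j′ s′ q → u s ℕ.* y j′ ≡ u s′ ℕ.* y j
  large-q⇒proportional {j} {j′} {s} {s′} {q} j<T j′<T s<N s′<N Q≤q b b′ =
    Sum.[ (λ q²∣- → ∣-∧<⇒≡ q²∣- (ℕ.≤-<-trans (ℕ.m≤m+n _ _) bound)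
                          (ℕ.≤-<-trans (ℕ.m≤n+m _ (u s ℕ.* y j′)) bound))
        , (λ q²∣+ → let sum≡0 = ∣∧∣∣<⇒≡0 q²∣+ bound in
             trans (ℕ.m+n≡0⇒m≡0 _ sum≡0) (sym (ℕ.m+n≡0⇒n≡0 (u s ℕ.* y j′) sum≡0)))
        ]′ (bad⇒sq∣ b b′)
    where bound = uy+uy<q² j<T j′<T s<N s′<N Q≤q

  large-q : ∀ {q} → Q ≤ q → Σ< T (λ j → Σ< N (λ s → bad j s q)) ≤ 1
  large-q {q} Q≤q = Σ<≤1 T one-s one-j
    where
    one-s : ∀ {j} → j < T → Σ< N (λ s → bad j s q) ≤ 1
    one-s {j} j<T = Σ<≤1 N (λ {s} _ → indicator≤1 (bad? j s q)) λ {s} {s′} s<s′ s′<N pos pos′ →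
      let b = indicator>0⇒ (bad? j s q) pos
          _ , _ , _ , _ , q∤y = bad⇒generic {j} {s} b
          instance _ = ℕ.≢-nonZero (λ y≡0 → q∤y (subst (λ a → + q ∣ₛ + a) (sym y≡0) (∣ᵤ⇒∣ (q ℕ.∣0))))
      in  ℕ.<⇒≢ s<s′ (u-cancel (ℕ.*-cancelʳ-≡ (u s) (u s′) (y j)
            (large-q⇒proportional j<T j<T (ℕ.<-trans s<s′ s′<N) s′<N Q≤q
              b (indicator>0⇒ (bad? j s′ q) pos′))))

    one-j : (λ j → Σ< N (λ s → bad j s q)) OneOn T
    one-j {j} {j′} j<j′ j′<T pos pos′ =
      let s  , s<N  , p  = Σ<>0⇒ N pos
          s′ , s′<N , p′ = Σ<>0⇒ N pos′
      in  slopes (K ℕ.+ s) (K ℕ.+ s′) j<j′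
            (large-q⇒proportional (ℕ.<-trans j<j′ j′<T) j′<T s<N s′<N Q≤q
              (indicator>0⇒ (bad? j s q) p) (indicator>0⇒ (bad? j′ s′ q) p′))

  bads : ℕ → ℕ → ℕ
  bads j s = Σ< (Q ℕ.+ B) (bad j s)

  total<TN : Σ< T (λ j → Σ< N (bads j)) < T ℕ.* N
  total<TN = begin-strict
    Σ< T (λ j → Σ< N (bads j))
      ≡⟨ Σ<-cong T (λ j → trans (Σ<-cong N (λ s → Σ<-split Q B (bad j s)))
                                (Σ<-+ N (λ s → Σ< Q (bad j s)) (λ s → Σ< B (bad′ j s)))) ⟩
    Σ< T (λ j → Σ< N (λ s → Σ< Q (bad j s)) ℕ.+ Σ< N (λ s → Σ< B (bad′ j s)))
      ≡⟨ Σ<-+ T (λ j → Σ< N (λ s → Σ< Q (bad j s))) (λ j → Σ< N (λ s → Σ< B (bad′ j s))) ⟩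
    Σ< T (λ j → Σ< N (λ s → Σ< Q (bad j s))) ℕ.+ Σ< T (λ j → Σ< N (λ s → Σ< B (bad′ j s)))
      ≤⟨ ℕ.+-mono-≤ (Σ<-bounded T (4 ℕ.* Q) (λ {j} _ → small-q j)) large≤B ⟩
    T ℕ.* (4 ℕ.* Q) ℕ.+ B
      <⟨ ℕ.+-monoʳ-< (T ℕ.* (4 ℕ.* Q)) B<T4Q ⟩
    T ℕ.* (4 ℕ.* Q) ℕ.+ T ℕ.* (4 ℕ.* Q)
      ≡⟨ lemma T Q ⟩
    T ℕ.* N ∎
    where
    open ℕ.≤-Reasoning
    bad′ : ℕ → ℕ → ℕ → ℕ
    bad′ j s i = bad j s (Q ℕ.+ i)
    lemma : ∀ T Q → T ℕ.* (4 ℕ.* Q) ℕ.+ T ℕ.* (4 ℕ.* Q) ≡ T ℕ.* (8 ℕ.* Q)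
    lemma = ℕR.solve-∀
    lemma′ : ∀ c Q → suc (4 ℕ.* suc c) ℕ.* (4 ℕ.* Q) ≡ 2 ℕ.* (suc c ℕ.* (8 ℕ.* Q)) ℕ.+ 4 ℕ.* Q
    lemma′ = ℕR.solve-∀
    B<T4Q : B < T ℕ.* (4 ℕ.* Q)
    B<T4Q = subst (B <_) (sym (lemma′ c Q)) (ℕ.m<m+n B z<s)
    large≤B : Σ< T (λ j → Σ< N (λ s → Σ< B (bad′ j s))) ≤ B
    large≤B = begin
      Σ< T (λ j → Σ< N (λ s → Σ< B (bad′ j s)))
        ≡⟨ Σ<-cong T (λ j → Σ<-swap N B (bad′ j)) ⟩
      Σ< T (λ j → Σ< B (λ i → Σ< N (λ s → bad′ j s i)))
        ≡⟨ Σ<-swap T B (λ j i → Σ< N (λ s → bad′ j s i)) ⟩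
      Σ< B (λ i → Σ< T (λ j → Σ< N (λ s → bad′ j s i)))
        ≤⟨ Σ<-bounded B 1 (λ {i} _ → large-q (ℕ.m≤m+n Q i)) ⟩
      B ℕ.* 1
        ≡⟨ ℕ.*-identityʳ B ⟩
      B ∎

  exists : ∃[ s ] ∃[ j ] X < ∣ norm D (u₀ ℕ.+ c ℕ.* s) (y j) ∣ ×
           (∀ {q} → Prime q → ¬ + (q ℕ.* q) ∣ₛ norm D (u₀ ℕ.+ c ℕ.* s) (y j))
  exists =
    let j , j<T , Σs<N = Σ<-least T N total<TN
        s , s<N , bads<1 = Σ<-least N 1 (subst (Σ< N (bads j) <_) (sym (ℕ.*-identityʳ N)) Σs<N)
    in  K ℕ.+ s , j , X<∣E∣ j<T s , λ {q} q-prime q²∣E →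
          let b = q-prime , q²∣E
          in  indicator≡0⇒ (bad? j s q)
                (Σ<≡0⇒ (Q ℕ.+ B) (ℕ.n<1⇒n≡0 bads<1) (ℕ.<-≤-trans (bad⇒<B j<T s<N b) (ℕ.m≤n+m B Q))) b

-- Congruences and squarefree parts

%ℕ-≡⇒∣- : ∀ p .{{_ : NonZero p}} i j → i ℤ.%ℕ p ≡ j ℤ.%ℕ p → + p ∣ₛ i ℤ.- j
%ℕ-≡⇒∣- p i j eq = divides (i ℤ./ℕ p ℤ.- j ℤ./ℕ p) (begin
  i ℤ.- j
    ≡⟨ cong₂ ℤ._-_ (ℤ.a≡a%ℕn+[a/ℕn]*n i p)
         (trans (ℤ.a≡a%ℕn+[a/ℕn]*n j p) (cong (λ r → + r ℤ.+ (j ℤ./ℕ p) ℤ.* + p) (sym eq))) ⟩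
  (+ (i ℤ.%ℕ p) ℤ.+ i ℤ./ℕ p ℤ.* + p) ℤ.- (+ (i ℤ.%ℕ p) ℤ.+ j ℤ./ℕ p ℤ.* + p)
    ≡⟨ lemma (+ (i ℤ.%ℕ p)) (i ℤ./ℕ p) (j ℤ./ℕ p) (+ p) ⟩
  (i ℤ./ℕ p ℤ.- j ℤ./ℕ p) ℤ.* + p ∎)
  where
  open ≡-Reasoning
  lemma : ∀ r a b p → (r ℤ.+ a ℤ.* p) ℤ.- (r ℤ.+ b ℤ.* p) ≡ (a ℤ.- b) ℤ.* p
  lemma = ℤR.solve-∀

injective-residues-meet : ∀ p .{{_ : NonZero p}} {a b} → p < a ℕ.+ b →
  (F : Fin a → ℤ) (G : Fin b → ℤ) →
  (∀ {i j} → + p ∣ₛ F i ℤ.- F j → i ≡ j) → (∀ {i j} → + p ∣ₛ G i ℤ.- G j → i ≡ j) →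
  ∃[ i ] ∃[ j ] + p ∣ₛ F i ℤ.- G j
injective-residues-meet p {a} {b} p<a+b F G F-inj G-inj = collide
  where
  H : Fin a ⊎ Fin b → ℤ
  H = Sum.[ F , G ]′

  residue : Fin a ⊎ Fin b → Fin p
  residue x = Fin.fromℕ< (ℤ.n%ℕd<d (H x) p)

  residue≡⇒ : ∀ {x y} → residue x ≡ residue y → + p ∣ₛ H x ℤ.- H y
  residue≡⇒ {x} {y} = %ℕ-≡⇒∣- p (H x) (H y) ∘ Fin.fromℕ<-injective _ _ _ _

  pick : ∀ x y → x ≢ y → residue x ≡ residue y → ∃[ i ] ∃[ j ] + p ∣ₛ F i ℤ.- G j
  pick (inj₁ i) (inj₁ j) x≢y eq = contradiction (cong inj₁ (F-inj (residue≡⇒ {inj₁ i} {inj₁ j} eq))) x≢y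
  pick (inj₁ i) (inj₂ j) x≢y eq = i , j , residue≡⇒ {inj₁ i} {inj₂ j} eq
  pick (inj₂ i) (inj₁ j) x≢y eq = j , i , residue≡⇒ {inj₁ j} {inj₂ i} (sym eq)
  pick (inj₂ i) (inj₂ j) x≢y eq = contradiction (cong inj₂ (G-inj (residue≡⇒ {inj₂ i} {inj₂ j} eq))) x≢y

  splitAt-injective : ∀ {i j} → splitAt a {b} i ≡ splitAt a j → i ≡ j
  splitAt-injective {i} {j} eq =
    trans (sym (Fin.join-splitAt a b i)) (trans (cong (Fin.join a b) eq) (Fin.join-splitAt a b j))

  collide : ∃[ i ] ∃[ j ] + p ∣ₛ F i ℤ.- G j
  collide = let i , j , i<j , eq = Fin.pigeonhole p<a+b (residue ∘ splitAt a)
            in  pick (splitAt a i) (splitAt a j) (Fin.<⇒≢ i<j ∘ splitAt-injective) eq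

scaled-squares-injective : ∀ {p h} → Prime p → p ≡ suc (h ℕ.+ h) → ∀ k → ¬ + p ∣ₛ k →
  ∀ {i j : Fin (suc h)} →
  + p ∣ₛ k ℤ.* (+ toℕ i ℤ.* + toℕ i) ℤ.- k ℤ.* (+ toℕ j ℤ.* + toℕ j) → i ≡ j
scaled-squares-injective {p} {h} p-prime refl k p∤k {i} {j} p∣ =
  Fin.toℕ-injective (Sum.[ ⊥-elim ∘ p∤k , (λ p∣ij → Sum.[ from- , from+ ]′ (prime∣*⇒∣⊎∣ p-prime _ _ p∣ij)) ]′
    (prime∣*⇒∣⊎∣ p-prime k _ (subst (+ p ∣ₛ_) (lemma k (+ toℕ i) (+ toℕ j)) p∣)))
  where
  i≤h : ∀ (i : Fin (suc h)) → toℕ i ≤ h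
  i≤h i = ℕ.≤-pred (Fin.toℕ<n i)
  i<p : ∀ (i : Fin (suc h)) → toℕ i < p
  i<p i = s≤s (ℕ.≤-trans (i≤h i) (ℕ.m≤m+n h h))
  from- : + p ∣ₛ + toℕ i ℤ.- + toℕ j → toℕ i ≡ toℕ j
  from- p∣- = ∣-∧<⇒≡ p∣- (i<p i) (i<p j)
  from+ : + p ∣ₛ + toℕ i ℤ.+ + toℕ j → toℕ i ≡ toℕ j
  from+ p∣+ = let sum≡0 = ∣∧∣∣<⇒≡0 p∣+ (s≤s (ℕ.+-mono-≤ (i≤h i) (i≤h j)))
              in trans (ℕ.m+n≡0⇒m≡0 (toℕ i) sum≡0) (sym (ℕ.m+n≡0⇒n≡0 (toℕ i) sum≡0))
  lemma : ∀ k i j → k ℤ.* (i ℤ.* i) ℤ.- k ℤ.* (j ℤ.* j) ≡ k ℤ.* ((i ℤ.- j) ℤ.* (i ℤ.+ j))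
  lemma = ℤR.solve-∀

odd-prime : ∀ {p} → Prime p → p ≢ 2 → ∃[ h ] p ≡ suc (h ℕ.+ h)
odd-prime {p} p-prime p≢2 with p ℕ.% 2 in eq | ℕ.m%n<n p 2
... | 0 | _ = Sum.[ (λ ()) , (λ 2≡p → contradiction (sym 2≡p) p≢2) ]′
                (prime⇒irreducible p-prime (ℕ.m%n≡0⇒n∣m p 2 eq))
... | 1 | _ = p ℕ./ 2 , (begin
  p                              ≡⟨ ℕ.m≡m%n+[m/n]*n p 2 ⟩
  p ℕ.% 2 ℕ.+ p ℕ./ 2 ℕ.* 2      ≡⟨ cong (ℕ._+ p ℕ./ 2 ℕ.* 2) eq ⟩
  suc (p ℕ./ 2 ℕ.* 2)            ≡⟨ cong suc (double (p ℕ./ 2)) ⟩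
  suc (p ℕ./ 2 ℕ.+ p ℕ./ 2)      ∎)
  where
  open ≡-Reasoning
  double : ∀ a → a ℕ.* 2 ≡ a ℕ.+ a
  double = ℕR.solve-∀
... | suc (suc _) | s≤s (s≤s ())

norm-represents : ∀ {p} → Prime p → p ≢ 2 → ∀ D d m → ¬ + p ∣ₛ D → ¬ + p ∣ₛ d →
                  ∃[ i ] ∃[ j ] j ≤ p × + p ∣ₛ d ℤ.* norm D i j ℤ.- m
norm-represents {p} p-prime p≢2 D d m p∤D p∤d =
  let i , j , p∣ = injective-residues-meet p {suc h} {suc h} p<
                     (λ i → d ℤ.* (+ toℕ i ℤ.* + toℕ i))
                     (λ j → m ℤ.+ (d ℤ.* D) ℤ.* (+ toℕ j ℤ.* + toℕ j))
                     (scaled-squares-injective p-prime p≡ d p∤d)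
                     (λ {i} {j} p∣ → scaled-squares-injective p-prime p≡ (d ℤ.* D) p∤dD
                       (subst (+ p ∣ₛ_) (cancel m (d ℤ.* D ℤ.* (+ toℕ i ℤ.* + toℕ i))
                                                (d ℤ.* D ℤ.* (+ toℕ j ℤ.* + toℕ j))) p∣))
  in  toℕ i , toℕ j , j≤p j , subst (+ p ∣ₛ_) (regroup d D m (+ toℕ i) (+ toℕ j)) p∣
  where
  instance _ = prime⇒nonZero p-prime
  h  = proj₁ (odd-prime p-prime p≢2)
  p≡ = proj₂ (odd-prime p-prime p≢2)
  p< : p < suc h ℕ.+ suc h
  p< = subst (_< suc h ℕ.+ suc h) (sym p≡) (s≤s (ℕ.≤-reflexive (sym (ℕ.+-suc h h))))
  j≤p : ∀ (j : Fin (suc h)) → toℕ j ≤ p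
  j≤p j = subst (toℕ j ≤_) (sym p≡)
    (ℕ.≤-trans (ℕ.≤-pred (Fin.toℕ<n j)) (ℕ.≤-trans (ℕ.m≤m+n h h) (ℕ.n≤1+n (h ℕ.+ h))))
  p∤dD : ¬ + p ∣ₛ d ℤ.* D
  p∤dD = Sum.[ p∤d , p∤D ]′ ∘ prime∣*⇒∣⊎∣ p-prime d D
  cancel : ∀ m a b → (m ℤ.+ a) ℤ.- (m ℤ.+ b) ≡ a ℤ.- b
  cancel = ℤR.solve-∀
  regroup : ∀ d D m i j → d ℤ.* (i ℤ.* i) ℤ.- (m ℤ.+ d ℤ.* D ℤ.* (j ℤ.* j)) ≡
                          d ℤ.* (i ℤ.* i ℤ.- D ℤ.* (j ℤ.* j)) ℤ.- m
  regroup = ℤR.solve-∀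

coprime-common-multiple : ∀ {p} → Prime p → ∀ z →
  ∃[ w ] ¬ p ℕ.∣ w × (∀ {n} → .{{NonZero n}} → n ≤ z → ¬ p ℕ.∣ n → n ℕ.∣ w)
coprime-common-multiple {p} p-prime zero =
  1 , (λ p∣1 → ¬prime[1] (subst Prime (ℕ.∣1⇒≡1 p∣1) p-prime))
    , λ { {suc _} () _ }
coprime-common-multiple {p} p-prime (suc z)
  with w , p∤w , multiple ← coprime-common-multiple p-prime z | p ℕ.∣? suc z
... | yes p∣1+z = w , p∤w , λ {n} n≤1+z p∤n →
  Sum.[ (λ n<1+z → multiple (ℕ.≤-pred n<1+z) p∤n)
      , (λ { refl → contradiction p∣1+z p∤n })
      ]′ (ℕ.m≤n⇒m<n∨m≡n n≤1+z)
... | no  p∤1+z = suc z ℕ.* w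
  , Sum.[ p∤1+z , p∤w ]′ ∘ euclidsLemma (suc z) w p-prime
  , λ {n} n≤1+z p∤n →
      Sum.[ (λ n<1+z → ℕ.∣n⇒∣m*n (suc z) (multiple (ℕ.≤-pred n<1+z) p∤n))
          , (λ { refl → ℕ.m∣m*n w })
          ]′ (ℕ.m≤n⇒m<n∨m≡n n≤1+z)

-- Bézout gives x w ≡ ±1, and squaring removes the sign.
unit-multiple : ∀ {p w} → Prime p → ¬ p ℕ.∣ w → ∃[ v ] w ℕ.∣ v × + p ∣ₛ + v ℤ.- 1ℤ
unit-multiple {p} {w} p-prime p∤w = from-Bézout (ℕ.coprime-Bézout coprime)
  where
  coprime : ℕ.Coprime w p
  coprime (d∣w , d∣p) with prime⇒irreducible p-prime d∣p
  ... | inj₁ d≡1  = d≡1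
  ... | inj₂ refl = contradiction d∣w p∤w

  square : ∀ x → + (x ℕ.* x) ℤ.- 1ℤ ≡ (+ x ℤ.- 1ℤ) ℤ.* (+ x ℤ.+ 1ℤ)
  square x = trans (cong (ℤ._- 1ℤ) (ℤ.pos-* x x)) (lemma (+ x))
    where
    lemma : ∀ x → x ℤ.* x ℤ.- 1ℤ ≡ (x ℤ.- 1ℤ) ℤ.* (x ℤ.+ 1ℤ)
    lemma = ℤR.solve-∀

  result : ∀ x → + p ∣ₛ + (x ℕ.* w) ℤ.- 1ℤ ⊎ + p ∣ₛ + (x ℕ.* w) ℤ.+ 1ℤ →
           ∃[ v ] w ℕ.∣ v × + p ∣ₛ + v ℤ.- 1ℤ
  result x p∣ = (x ℕ.* w) ℕ.* (x ℕ.* w) , ℕ.∣n⇒∣m*n (x ℕ.* w) (ℕ.n∣m*n x)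
    , subst (+ p ∣ₛ_) (sym (square (x ℕ.* w)))
        (Sum.[ ∣m⇒∣m*n _ , ∣n⇒∣m*n (+ (x ℕ.* w) ℤ.- 1ℤ) ]′ p∣)

  from-Bézout : Bézout.Identity 1 w p → ∃[ v ] w ℕ.∣ v × + p ∣ₛ + v ℤ.- 1ℤ
  from-Bézout (Bézout.+- x y 1+yp≡xw) = result x (inj₁ (divides (+ y) (begin
    + (x ℕ.* w) ℤ.- 1ℤ         ≡⟨ cong (λ a → + a ℤ.- 1ℤ) 1+yp≡xw ⟨
    + (y ℕ.* p)                ≡⟨ ℤ.pos-* y p ⟩
    + y ℤ.* + p                ∎)))
    where open ≡-Reasoning
  from-Bézout (Bézout.-+ x y 1+xw≡yp) = result x (inj₂ (divides (+ y) (begin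
    + (x ℕ.* w ℕ.+ 1)          ≡⟨ cong +_ (ℕ.+-comm (x ℕ.* w) 1) ⟩
    + (1 ℕ.+ x ℕ.* w)          ≡⟨ cong +_ 1+xw≡yp ⟩
    + (y ℕ.* p)                ≡⟨ ℤ.pos-* y p ⟩
    + y ℤ.* + p                ∎)))
    where open ≡-Reasoning

prime-divisor : ∀ n → .{{NonTrivial n}} → ∃[ q ] Prime q × q ℕ.∣ n
prime-divisor n@(suc (suc _)) with factorise n
... | record { factors = []     ; isFactorisation = () }
... | record { factors = q ∷ qs ; isFactorisation = eq ; factorsPrime = q-prime ∷ _ } =
  q , q-prime , subst (q ℕ.∣_) (sym eq) (ℕ.m∣m*n _)

squarefree : ∀ d → d ≢ 0ℤ → (∀ {q} → Prime q → ¬ + (q ℕ.* q) ∣ₛ d) → Squarefree d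
squarefree d d≢0 sqf = d≢0 , unit
  where
  unit : ∀ k → ∣ k ℤ.* k ∣ ℕ.∣ ∣ d ∣ → ∣ k ∣ ≡ 1
  unit k k²∣d with ∣ k ∣ | subst (ℕ._∣ ∣ d ∣) (ℤ.abs-* k k) k²∣d
  ... | 0 | 0∣d = contradiction (ℤ.∣i∣≡0⇒i≡0 (ℕ.0∣⇒≡0 0∣d)) d≢0
  ... | 1 | _   = refl
  ... | n@(suc (suc _)) | n²∣d =
    let q , q-prime , q∣n = prime-divisor n
    in  contradiction (∣ᵤ⇒∣ (ℕ.∣-trans (ℕ.*-pres-∣ q∣n q∣n) n²∣d)) (sqf q-prime)

squarefree-decomposition : ∀ a → a ≢ 0ℤ →
  ∃[ d ] ∃[ k ] a ≡ d ℤ.* (k ℤ.* k) × (∀ {q} → Prime q → ¬ + (q ℕ.* q) ∣ₛ d)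
squarefree-decomposition a a≢0 = <-rec P step ∣ a ∣ a refl a≢0
  where
  P : ℕ → Set
  P n = ∀ a → ∣ a ∣ ≡ n → a ≢ 0ℤ →
        ∃[ d ] ∃[ k ] a ≡ d ℤ.* (k ℤ.* k) × (∀ {q} → Prime q → ¬ + (q ℕ.* q) ∣ₛ d)
  step : ∀ n → (∀ {m} → m < n → P m) → P n
  step n rec a refl a≢0
    with ℕ.anyUpTo? (λ q → prime? q ×-dec (+ (q ℕ.* q) ∣? a)) (suc ∣ a ∣)
  ... | no ¬any = a , 1ℤ , sym (ℤ.*-identityʳ a) , λ {q} q-prime q²∣a →
    let instance _ = prime⇒nonZero q-prime
                 _ = ℕ.≢-nonZero (a≢0 ∘ ℤ.∣i∣≡0⇒i≡0)
    in  ¬any (q , s≤s (ℕ.≤-trans (ℕ.m≤m*n q q) (ℕ.∣⇒≤ (∣⇒∣ᵤ q²∣a))) , q-prime , q²∣a)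
  ... | yes (q , _ , q-prime , divides b a≡bq²) =
    let instance _ = ℕ.≢-nonZero (b≢0 ∘ ℤ.∣i∣≡0⇒i≡0)
                 _ = prime⇒nonTrivial q-prime
        ∣b∣<∣a∣ = subst (∣ b ∣ <_) (sym (trans (cong ∣_∣ a≡bq²) (ℤ.abs-* b (+ (q ℕ.* q)))))
                   (ℕ.m<m*n ∣ b ∣ (q ℕ.* q) 1<q²)
        d , k , b≡dk² , sqf = rec ∣b∣<∣a∣ b refl b≢0
    in  d , k ℤ.* + q , trans a≡bq² (trans (cong₂ ℤ._*_ b≡dk² (ℤ.pos-* q q)) (lemma d k (+ q))) , sqf
    where
    b≢0 : b ≢ 0ℤ
    b≢0 refl = a≢0 a≡bq²
    1<q² : 1 < q ℕ.* q
    1<q² = let 1<q = ℕ.nonTrivial⇒n>1 q {{prime⇒nonTrivial q-prime}}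
           in  ℕ.*-mono-< {1} {q} {1} {q} 1<q 1<q
    lemma : ∀ d k q → d ℤ.* (k ℤ.* k) ℤ.* (q ℤ.* q) ≡ d ℤ.* ((k ℤ.* q) ℤ.* (k ℤ.* q))
    lemma = ℤR.solve-∀

-- Rational values of a quadratic polynomial

toℚᵘ-toℚ : ∀ n → ℚ.toℚᵘ (toℚ n) ℚᵘ.≃ ℚᵘ.mkℚᵘ n 0
toℚᵘ-toℚ n = ℚ.toℚᵘ-fromℚᵘ (ℚᵘ.mkℚᵘ n 0)

toℚ-+ : ∀ m n → toℚ (m ℤ.+ n) ≡ toℚ m ℚ.+ toℚ n
toℚ-+ m n = ℚ.toℚᵘ-injective (begin
  ℚ.toℚᵘ (toℚ (m ℤ.+ n))                    ≈⟨ toℚᵘ-toℚ (m ℤ.+ n) ⟩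
  ℚᵘ.mkℚᵘ (m ℤ.+ n) 0                        ≈⟨ ℚᵘ.*≡* (lemma m n) ⟩
  ℚᵘ.mkℚᵘ m 0 ℚᵘ.+ ℚᵘ.mkℚᵘ n 0              ≈⟨ ℚᵘ.+-cong (toℚᵘ-toℚ m) (toℚᵘ-toℚ n) ⟨
  ℚ.toℚᵘ (toℚ m) ℚᵘ.+ ℚ.toℚᵘ (toℚ n)        ≈⟨ ℚ.toℚᵘ-homo-+ (toℚ m) (toℚ n) ⟨
  ℚ.toℚᵘ (toℚ m ℚ.+ toℚ n)                  ∎)
  where
  open ℚᵘ.≃-Reasoning
  lemma : ∀ m n → (m ℤ.+ n) ℤ.* 1ℤ ≡ (m ℤ.* 1ℤ ℤ.+ n ℤ.* 1ℤ) ℤ.* 1ℤ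
  lemma = ℤR.solve-∀

toℚ-* : ∀ m n → toℚ (m ℤ.* n) ≡ toℚ m ℚ.* toℚ n
toℚ-* m n = ℚ.toℚᵘ-injective (begin
  ℚ.toℚᵘ (toℚ (m ℤ.* n))                    ≈⟨ toℚᵘ-toℚ (m ℤ.* n) ⟩
  ℚᵘ.mkℚᵘ m 0 ℚᵘ.* ℚᵘ.mkℚᵘ n 0              ≈⟨ ℚᵘ.*-cong (toℚᵘ-toℚ m) (toℚᵘ-toℚ n) ⟨
  ℚ.toℚᵘ (toℚ m) ℚᵘ.* ℚ.toℚᵘ (toℚ n)        ≈⟨ ℚ.toℚᵘ-homo-* (toℚ m) (toℚ n) ⟨
  ℚ.toℚᵘ (toℚ m ℚ.* toℚ n)                  ∎)
  where open ℚᵘ.≃-Reasoning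

toℚ-injective : ∀ {m n} → toℚ m ≡ toℚ n → m ≡ n
toℚ-injective {m} {n} eq
  with ℚᵘ.*≡* m*1≡n*1 ← ℚᵘ.≃-trans (ℚᵘ.≃-sym (toℚᵘ-toℚ m))
                          (ℚᵘ.≃-trans (ℚᵘ.≃-reflexive (cong ℚ.toℚᵘ eq)) (toℚᵘ-toℚ n))
  = trans (sym (ℤ.*-identityʳ m)) (trans m*1≡n*1 (ℤ.*-identityʳ n))

toℚ-inverse : ∀ t → t ≢ 0ℤ → ∃[ v ] toℚ t ℚ.* v ≡ 1ℚ
toℚ-inverse t t≢0 = ℚ.1/_ (toℚ t) {{nz}} , ℚ.*-inverseʳ (toℚ t) {{nz}}
  where nz = ℚ.≢-nonZero (t≢0 ∘ toℚ-injective {t} {0ℤ})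

eval-zero : ∀ g → (∀ n → ℤ[x].coeff g n ≡ 0ℤ) → ∀ r → ℚ[x].eval (toℚ[x] g) r ≡ 0ℚ
eval-zero []      g≡0 r = refl
eval-zero (b ∷ g) g≡0 r
  rewrite g≡0 0 | eval-zero g (λ n → g≡0 (suc n)) r = trans (ℚ.+-identityˡ _) (ℚ.*-zeroʳ r)

private
  open +-*-Solver
  pad : ∀ C R B A → C ℚ.+ R ℚ.* (B ℚ.+ R ℚ.* (A ℚ.+ R ℚ.* 0ℚ)) ≡
                    C ℚ.* (1ℚ ℚ.* 1ℚ) ℚ.+ R ℚ.* (B ℚ.* 1ℚ ℚ.+ R ℚ.* A)
  pad = solve 4 (λ C R B A → C :+ R :* (B :+ R :* (A :+ R :* con 0ℚ)) :=
                             C :* (con 1ℚ :* con 1ℚ) :+ R :* (B :* con 1ℚ :+ R :* A)) refl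
  collect : ∀ C T v B N A →
    C ℚ.* (T ℚ.* v ℚ.* (T ℚ.* v)) ℚ.+ (N ℚ.* v) ℚ.* (B ℚ.* (T ℚ.* v) ℚ.+ (N ℚ.* v) ℚ.* A) ≡
    (C ℚ.* (T ℚ.* T) ℚ.+ B ℚ.* (N ℚ.* T) ℚ.+ A ℚ.* (N ℚ.* N)) ℚ.* (v ℚ.* v)
  collect = solve 6 (λ C T v B N A →
    C :* (T :* v :* (T :* v)) :+ (N :* v) :* (B :* (T :* v) :+ (N :* v) :* A) :=
    (C :* (T :* T) :+ B :* (N :* T) :+ A :* (N :* N)) :* (v :* v)) refl
  interchange : ∀ x k v → x ℚ.* (k ℚ.* k) ℚ.* (v ℚ.* v) ≡ x ℚ.* ((k ℚ.* v) ℚ.* (k ℚ.* v))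
  interchange = solve 3 (λ x k v → x :* (k :* k) :* (v :* v) := x :* ((k :* v) :* (k :* v))) refl
  clear : ∀ x t v → x ℚ.* (t ℚ.* v ℚ.* (t ℚ.* v)) ≡ x ℚ.* (v ℚ.* v) ℚ.* (t ℚ.* t)
  clear = solve 3 (λ x t v → x :* (t :* v :* (t :* v)) := x :* (v :* v) :* (t :* t)) refl

private
  toℚ-*³ : ∀ x y z → toℚ (x ℤ.* (y ℤ.* z)) ≡ toℚ x ℚ.* (toℚ y ℚ.* toℚ z)
  toℚ-*³ x y z = trans (toℚ-* x (y ℤ.* z)) (cong (toℚ x ℚ.*_) (toℚ-* y z))

  toℚ-form : ∀ a b c n t → toℚ (c ℤ.* (t ℤ.* t) ℤ.+ b ℤ.* (n ℤ.* t) ℤ.+ a ℤ.* (n ℤ.* n)) ≡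
             toℚ c ℚ.* (toℚ t ℚ.* toℚ t) ℚ.+ toℚ b ℚ.* (toℚ n ℚ.* toℚ t) ℚ.+ toℚ a ℚ.* (toℚ n ℚ.* toℚ n)
  toℚ-form a b c n t = trans (toℚ-+ (c ℤ.* (t ℤ.* t) ℤ.+ b ℤ.* (n ℤ.* t)) (a ℤ.* (n ℤ.* n)))
    (cong₂ ℚ._+_ (trans (toℚ-+ (c ℤ.* (t ℤ.* t)) (b ℤ.* (n ℤ.* t)))
                   (cong₂ ℚ._+_ (toℚ-*³ c t t) (toℚ-*³ b n t)))
                 (toℚ-*³ a n n))

  horner : ∀ C B A N T v E → E ≡ 0ℚ → T ℚ.* v ≡ 1ℚ →
    C ℚ.+ (N ℚ.* v) ℚ.* (B ℚ.+ (N ℚ.* v) ℚ.* (A ℚ.+ (N ℚ.* v) ℚ.* E)) ≡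
    (C ℚ.* (T ℚ.* T) ℚ.+ B ℚ.* (N ℚ.* T) ℚ.+ A ℚ.* (N ℚ.* N)) ℚ.* (v ℚ.* v)
  horner C B A N T v E E≡0 tv≡1 = begin
    C ℚ.+ R ℚ.* (B ℚ.+ R ℚ.* (A ℚ.+ R ℚ.* E))
      ≡⟨ cong (λ e → C ℚ.+ R ℚ.* (B ℚ.+ R ℚ.* (A ℚ.+ R ℚ.* e))) E≡0 ⟩
    C ℚ.+ R ℚ.* (B ℚ.+ R ℚ.* (A ℚ.+ R ℚ.* 0ℚ))
      ≡⟨ pad C R B A ⟩
    C ℚ.* (1ℚ ℚ.* 1ℚ) ℚ.+ R ℚ.* (B ℚ.* 1ℚ ℚ.+ R ℚ.* A)
      ≡⟨ cong (λ e → C ℚ.* (e ℚ.* e) ℚ.+ R ℚ.* (B ℚ.* e ℚ.+ R ℚ.* A)) tv≡1 ⟨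
    C ℚ.* (T ℚ.* v ℚ.* (T ℚ.* v)) ℚ.+ R ℚ.* (B ℚ.* (T ℚ.* v) ℚ.+ R ℚ.* A)
      ≡⟨ collect C T v B N A ⟩
    (C ℚ.* (T ℚ.* T) ℚ.+ B ℚ.* (N ℚ.* T) ℚ.+ A ℚ.* (N ℚ.* N)) ℚ.* (v ℚ.* v) ∎
    where
    open ≡-Reasoning
    R = N ℚ.* v

-- f(n/t) = (c t² + b n t + a n²)/t², with v = 1/t.
eval-quotient : ∀ a b c g → (∀ n → ℤ[x].coeff g n ≡ 0ℤ) → ∀ n t v → toℚ t ℚ.* v ≡ 1ℚ →
  ℚ[x].eval (toℚ[x] (c ∷ b ∷ a ∷ g)) (toℚ n ℚ.* v) ≡
  toℚ (c ℤ.* (t ℤ.* t) ℤ.+ b ℤ.* (n ℤ.* t) ℤ.+ a ℤ.* (n ℤ.* n)) ℚ.* (v ℚ.* v)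
eval-quotient a b c g g≡0 n t v tv≡1 =
  trans (horner (toℚ c) (toℚ b) (toℚ a) (toℚ n) (toℚ t) v _ (eval-zero g g≡0 (toℚ n ℚ.* v)) tv≡1)
        (cong (ℚ._* (v ℚ.* v)) (sym (toℚ-form a b c n t)))

isSquarefreePart : ∀ {r x s k t v} → r ≡ toℚ x ℚ.* (v ℚ.* v) → toℚ t ℚ.* v ≡ 1ℚ →
                   x ≡ s ℤ.* (k ℤ.* k) → x ≢ 0ℤ → Squarefree s → r ≢ 0ℚ × IsSquarefreePart r s
isSquarefreePart {r} {x} {s} {k} {t} {v} r≡xv² tv≡1 x≡sk² x≢0 s-sqf =
  r≢0 , s-sqf , toℚ k ℚ.* v , r≡sq²
  where
  open ≡-Reasoning

  r≡sq² : r ≡ toℚ s ℚ.* ((toℚ k ℚ.* v) ℚ.* (toℚ k ℚ.* v))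
  r≡sq² = begin
    r                                                    ≡⟨ r≡xv² ⟩
    toℚ x ℚ.* (v ℚ.* v)                                  ≡⟨ cong (λ i → toℚ i ℚ.* (v ℚ.* v)) x≡sk² ⟩
    toℚ (s ℤ.* (k ℤ.* k)) ℚ.* (v ℚ.* v)                  ≡⟨ cong (ℚ._* (v ℚ.* v)) (toℚ-*³ s k k) ⟩
    toℚ s ℚ.* (toℚ k ℚ.* toℚ k) ℚ.* (v ℚ.* v)            ≡⟨ interchange (toℚ s) (toℚ k) v ⟩
    toℚ s ℚ.* ((toℚ k ℚ.* v) ℚ.* (toℚ k ℚ.* v))          ∎

  r≢0 : r ≢ 0ℚ
  r≢0 r≡0 = x≢0 (toℚ-injective {x} {0ℤ} (begin
    toℚ x                                              ≡⟨ ℚ.*-identityʳ (toℚ x) ⟨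
    toℚ x ℚ.* (1ℚ ℚ.* 1ℚ)                              ≡⟨ cong (λ i → toℚ x ℚ.* (i ℚ.* i)) tv≡1 ⟨
    toℚ x ℚ.* (toℚ t ℚ.* v ℚ.* (toℚ t ℚ.* v))          ≡⟨ clear (toℚ x) (toℚ t) v ⟩
    toℚ x ℚ.* (v ℚ.* v) ℚ.* (toℚ t ℚ.* toℚ t)
      ≡⟨ cong (ℚ._* (toℚ t ℚ.* toℚ t)) (trans (sym r≡xv²) r≡0) ⟩
    0ℚ ℚ.* (toℚ t ℚ.* toℚ t)                           ≡⟨ ℚ.*-zeroˡ (toℚ t ℚ.* toℚ t) ⟩
    0ℚ                                                 ∎))

disc : ℤ → ℤ → ℤ → ℤ
disc a b c = b ℤ.* b ℤ.- + 4 ℤ.* (a ℤ.* c)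

private
  complete-square : ∀ a b c u y →
    c ℤ.* ((+ 2 ℤ.* (a ℤ.* y)) ℤ.* (+ 2 ℤ.* (a ℤ.* y))) ℤ.+
    b ℤ.* ((u ℤ.- b ℤ.* y) ℤ.* (+ 2 ℤ.* (a ℤ.* y))) ℤ.+
    a ℤ.* ((u ℤ.- b ℤ.* y) ℤ.* (u ℤ.- b ℤ.* y)) ≡
    a ℤ.* (u ℤ.* u ℤ.- (b ℤ.* b ℤ.- + 4 ℤ.* (a ℤ.* c)) ℤ.* (y ℤ.* y))
  complete-square = ℤR.solve-∀

  regroup : ∀ d k e → d ℤ.* (k ℤ.* k) ℤ.* e ≡ (d ℤ.* e) ℤ.* (k ℤ.* k)
  regroup = ℤR.solve-∀

*-≢0 : ∀ {i j} → i ≢ 0ℤ → j ≢ 0ℤ → i ℤ.* j ≢ 0ℤ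
*-≢0 {i} i≢0 j≢0 ij≡0 with ℤ.i*j≡0⇒i≡0∨j≡0 i ij≡0
... | inj₁ i≡0 = i≢0 i≡0
... | inj₂ j≡0 = j≢0 j≡0

norm∈𝒮 : ∀ a b c g → (∀ n → ℤ[x].coeff g n ≡ 0ℤ) →
  ∀ u y d k → y ≢ 0ℤ → a ≢ 0ℤ → a ≡ d ℤ.* (k ℤ.* k) →
  ∀ e → e ≡ u ℤ.* u ℤ.- disc a b c ℤ.* (y ℤ.* y) → e ≢ 0ℤ →
  Squarefree (d ℤ.* e) → 𝒮 (c ∷ b ∷ a ∷ g) (d ℤ.* e)
norm∈𝒮 a b c g g≡0 u y d k y≢0 a≢0 a≡dk² e e≡ e≢0 de-sqf =
  let v , tv≡1 = toℚ-inverse t (*-≢0 {+ 2} (λ ()) (*-≢0 a≢0 y≢0))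
  in  toℚ n ℚ.* v , isSquarefreePart {k = k} {t = t} (eval-quotient a b c g g≡0 n t v tv≡1) tv≡1
        (trans value≡ae (trans (cong (ℤ._* e) a≡dk²) (regroup d k e)))
        (*-≢0 a≢0 e≢0 ∘ trans (sym value≡ae)) de-sqf
  where
  n t : ℤ
  n = u ℤ.- b ℤ.* y
  t = + 2 ℤ.* (a ℤ.* y)
  value≡ae : c ℤ.* (t ℤ.* t) ℤ.+ b ℤ.* (n ℤ.* t) ℤ.+ a ℤ.* (n ℤ.* n) ≡ a ℤ.* e
  value≡ae = trans (complete-square a b c u y) (cong (a ℤ.*_) (sym e≡))

-- The progressions of u and y

prime∣^⇒∣ : ∀ {q} → Prime q → ∀ w n → q ℕ.∣ w ℕ.^ n → q ℕ.∣ w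
prime∣^⇒∣ q-prime w zero    q∣1 = contradiction (subst Prime (ℕ.∣1⇒≡1 q∣1) q-prime) ¬prime[1]
prime∣^⇒∣ q-prime w (suc n) q∣  =
  Sum.[ (λ q∣w → q∣w) , prime∣^⇒∣ q-prime w n ]′ (euclidsLemma w (w ℕ.^ n) q-prime q∣)

∣-1⇒∣^-1 : ∀ {k} w n → k ∣ₛ + w ℤ.- 1ℤ → k ∣ₛ + (w ℕ.^ n) ℤ.- 1ℤ
∣-1⇒∣^-1 {k} w zero    k∣ = divides 0ℤ refl
∣-1⇒∣^-1 {k} w (suc n) k∣ =
  subst (k ∣ₛ_) (sym (trans (cong (ℤ._- 1ℤ) (ℤ.pos-* w (w ℕ.^ n))) (lemma (+ w) (+ (w ℕ.^ n)))))
    (∣m∣n⇒∣m+n (∣n⇒∣m*n (+ w) (∣-1⇒∣^-1 w n k∣)) k∣)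
  where
  lemma : ∀ w v → w ℤ.* v ℤ.- 1ℤ ≡ w ℤ.* (v ℤ.- 1ℤ) ℤ.+ (w ℤ.- 1ℤ)
  lemma = ℤR.solve-∀

norm-mod : ∀ {k} D u y u′ y′ → k ∣ₛ + u ℤ.- + u′ → k ∣ₛ + y ℤ.- + y′ →
           k ∣ₛ norm D u y ℤ.- norm D u′ y′
norm-mod {k} D u y u′ y′ k∣u k∣y =
  subst (k ∣ₛ_) (sym (lemma D (+ u) (+ y) (+ u′) (+ y′)))
    (∣m∣n⇒∣m-n (∣m⇒∣m*n _ k∣u) (∣n⇒∣m*n D (∣m⇒∣m*n _ k∣y)))
  where
  lemma : ∀ D u y u′ y′ → (u ℤ.* u ℤ.- D ℤ.* (y ℤ.* y)) ℤ.- (u′ ℤ.* u′ ℤ.- D ℤ.* (y′ ℤ.* y′)) ≡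
          (u ℤ.- u′) ℤ.* (u ℤ.+ u′) ℤ.- D ℤ.* ((y ℤ.- y′) ℤ.* (y ℤ.+ y′))
  lemma = ℤR.solve-∀

prime∣prime⇒≡ : ∀ {p q} → Prime p → Prime q → p ℕ.∣ q → p ≡ q
prime∣prime⇒≡ p-prime q-prime p∣q with prime⇒irreducible q-prime p∣q
... | inj₁ refl = contradiction p-prime ¬prime[1]
... | inj₂ p≡q  = p≡q

prime∣∧≤⇒≤ : ∀ {q i z} → + q ∣ₛ i → i ≢ 0ℤ → ∣ i ∣ ≤ z → q ≤ z
prime∣∧≤⇒≤ q∣i i≢0 ∣i∣≤z =
  ℕ.≤-trans (ℕ.∣⇒≤ {{ℕ.≢-nonZero (i≢0 ∘ ℤ.∣i∣≡0⇒i≡0)}} (∣⇒∣ᵤ q∣i)) ∣i∣≤z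

-- i and j solve the congruence modulo p, while modulo W we have u ≡ p and y ≡ 0, so
-- that the norm is a unit.
module Progression
  {p} (p-prime : Prime p) (p≢2 : p ≢ 2) (D d m : ℤ) (p∤D : ¬ + p ∣ₛ D) (p∤d : ¬ + p ∣ₛ d)
  (p∤m : ¬ + p ∣ₛ m) (z : ℕ) (8≤z : 8 ≤ z) (2p≤z : p ℕ.+ p ≤ z) (D≤z : ∣ D ∣ ≤ z)
  (i j : ℕ) (j≤p : j ≤ p) (p∣dn-m : + p ∣ₛ d ℤ.* norm D i j ℤ.- m)
  (W : ℕ) (p∣W-1 : + p ∣ₛ + W ℤ.- 1ℤ)
  (multiple : ∀ {n} → .{{NonZero n}} → n ≤ z → ¬ p ℕ.∣ n → n ℕ.∣ W)
  where

  instance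
    p≢0 : NonZero p
    p≢0 = prime⇒nonZero p-prime

  p∤W : ¬ p ℕ.∣ W
  p∤W p∣W = ¬prime[1] (subst Prime (ℕ.∣1⇒≡1 (∣⇒∣ᵤ p∣1)) p-prime)
    where
    lemma : ∀ w → w ℤ.- (w ℤ.- 1ℤ) ≡ 1ℤ
    lemma = ℤR.solve-∀
    p∣1 : + p ∣ₛ 1ℤ
    p∣1 = subst (+ p ∣ₛ_) (lemma (+ W)) (∣m∣n⇒∣m-n (∣ᵤ⇒∣ {+ p} {+ W} p∣W) p∣W-1)

  instance
    W≢0 : NonZero W
    W≢0 = ℕ.≢-nonZero (λ W≡0 → p∤W (subst (p ℕ.∣_) (sym W≡0) (p ℕ.∣0)))
    c≢0 : NonZero (p ℕ.* W)
    c≢0 = ℕ.m*n≢0 p W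

  u₀ c : ℕ
  u₀ = i ℕ.* W ℕ.+ p
  c  = p ℕ.* W

  u y : ℕ → ℕ
  u s = u₀ ℕ.+ c ℕ.* s
  y t = (j ℕ.+ p) ℕ.* W ℕ.^ suc t

  instance
    j+p≢0 : NonZero (j ℕ.+ p)
    j+p≢0 = ℕ.>-nonZero (ℕ.<-≤-trans (ℕ.>-nonZero⁻¹ p) (ℕ.m≤n+m p j))

  y≢0 : ∀ t → NonZero (y t)
  y≢0 t = ℕ.m*n≢0 (j ℕ.+ p) (W ℕ.^ suc t) {{j+p≢0}} {{ℕ.m^n≢0 W (suc t)}}

  prime∣W∤u : ∀ {q} → Prime q → q ℕ.∣ W → ∀ s → ¬ q ℕ.∣ u s
  prime∣W∤u {q} q-prime q∣W s q∣u = p∤W (subst (ℕ._∣ W) (prime∣prime⇒≡ q-prime p-prime q∣p) q∣W)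
    where
    q∣p : q ℕ.∣ p
    q∣p = ℕ.∣m+n∣m⇒∣n
      (ℕ.∣m+n∣m⇒∣n (subst (q ℕ.∣_) (ℕ.+-comm u₀ (c ℕ.* s)) q∣u) (ℕ.∣m⇒∣m*n s (ℕ.∣n⇒∣m*n p q∣W)))
      (ℕ.∣n⇒∣m*n i q∣W)

  W∣y : ∀ t → W ℕ.∣ y t
  W∣y t = ℕ.∣n⇒∣m*n (j ℕ.+ p) (ℕ.m∣m*n (W ℕ.^ t))

  p∣u-i : ∀ s → + p ∣ₛ + u s ℤ.- + i
  p∣u-i s = subst (+ p ∣ₛ_) (sym u-i≡)
    (∣m∣n⇒∣m+n (∣n⇒∣m*n (+ i) p∣W-1) (∣m⇒∣m*n (1ℤ ℤ.+ + W ℤ.* + s) ∣-refl))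
    where
    lemma : ∀ i W p s → (i ℤ.* W ℤ.+ p ℤ.+ p ℤ.* W ℤ.* s) ℤ.- i ≡ i ℤ.* (W ℤ.- 1ℤ) ℤ.+ p ℤ.* (1ℤ ℤ.+ W ℤ.* s)
    lemma = ℤR.solve-∀
    u-i≡ : + u s ℤ.- + i ≡ + i ℤ.* (+ W ℤ.- 1ℤ) ℤ.+ + p ℤ.* (1ℤ ℤ.+ + W ℤ.* + s)
    u-i≡ = trans (cong (ℤ._- + i) (cong₂ ℤ._+_ (cong (ℤ._+ + p) (ℤ.pos-* i W))
             (trans (ℤ.pos-* (p ℕ.* W) s) (cong (ℤ._* + s) (ℤ.pos-* p W)))))
             (lemma (+ i) (+ W) (+ p) (+ s))

  p∣y-j : ∀ t → + p ∣ₛ + y t ℤ.- + j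
  p∣y-j t = subst (+ p ∣ₛ_) (sym y-j≡)
    (∣m∣n⇒∣m+n (∣n⇒∣m*n (+ j ℤ.+ + p) (∣-1⇒∣^-1 W (suc t) p∣W-1)) ∣-refl)
    where
    lemma : ∀ j p w → (j ℤ.+ p) ℤ.* w ℤ.- j ≡ (j ℤ.+ p) ℤ.* (w ℤ.- 1ℤ) ℤ.+ p
    lemma = ℤR.solve-∀
    y-j≡ : + y t ℤ.- + j ≡ (+ j ℤ.+ + p) ℤ.* (+ (W ℕ.^ suc t) ℤ.- 1ℤ) ℤ.+ + p
    y-j≡ = trans (cong (ℤ._- + j) (ℤ.pos-* (j ℕ.+ p) (W ℕ.^ suc t))) (lemma (+ j) (+ p) (+ (W ℕ.^ suc t)))

  dnorm≡m : ∀ s t → + p ∣ₛ d ℤ.* norm D (u s) (y t) ℤ.- m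
  dnorm≡m s t = subst (+ p ∣ₛ_) (lemma d (norm D (u s) (y t)) (norm D i j) m)
    (∣m∣n⇒∣m+n (∣n⇒∣m*n d (norm-mod D (u s) (y t) i j (p∣u-i s) (p∣y-j t))) p∣dn-m)
    where
    lemma : ∀ d a b m → d ℤ.* (a ℤ.- b) ℤ.+ (d ℤ.* b ℤ.- m) ≡ d ℤ.* a ℤ.- m
    lemma = ℤR.solve-∀

  p∤norm : ∀ s t → ¬ + p ∣ₛ norm D (u s) (y t)
  p∤norm s t p∣n = p∤m (subst (+ p ∣ₛ_) (lemma (d ℤ.* norm D (u s) (y t)) m)
    (∣m∣n⇒∣m-n (∣n⇒∣m*n d p∣n) (dnorm≡m s t)))
    where
    lemma : ∀ a m → a ℤ.- (a ℤ.- m) ≡ m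
    lemma = ℤR.solve-∀

  prime∣norm⇒∤W : ∀ s t {q} → Prime q → + q ∣ₛ norm D (u s) (y t) → ¬ q ℕ.∣ W
  prime∣norm⇒∤W s t {q} q-prime q∣n q∣W =
    prime∣W∤u q-prime q∣W s (∣⇒∣ᵤ (prime∣i²⇒∣i q-prime (+ u s)
      (subst (+ q ∣ₛ_) (lemma (+ u s ℤ.* + u s) (D ℤ.* (+ y t ℤ.* + y t)))
        (∣m∣n⇒∣m+n q∣n (∣n⇒∣m*n D (∣m⇒∣m*n (+ y t) (∣ᵤ⇒∣ {+ q} {+ y t} (ℕ.∣-trans q∣W (W∣y t)))))))))
    where
    lemma : ∀ a b → (a ℤ.- b) ℤ.+ b ≡ a
    lemma = ℤR.solve-∀

  prime∣norm⇒large : ∀ s t {q} → Prime q → + q ∣ₛ norm D (u s) (y t) → z < q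
  prime∣norm⇒large s t {q} q-prime q∣n = ℕ.≰⇒> λ q≤z →
    prime∣norm⇒∤W s t q-prime q∣n (multiple {{prime⇒nonZero q-prime}} q≤z λ p∣q →
      p∤norm s t (subst (λ q → + q ∣ₛ _) (sym (prime∣prime⇒≡ p-prime q-prime p∣q)) q∣n))

  generic : ∀ s t {q} → Prime q → + q ∣ₛ norm D (u s) (y t) →
            z < q × ¬ + q ∣ₛ + 2 × ¬ + q ∣ₛ D × ¬ + q ∣ₛ + c × ¬ + q ∣ₛ + y t
  generic s t {q} q-prime q∣n =
    z<q
    , (λ q∣2 → small q∣2 (λ ()) (ℕ.≤-trans (s≤s (s≤s z≤n)) 8≤z))
    , (λ q∣D → small q∣D (λ { refl → p∤D (∣ᵤ⇒∣ (p ℕ.∣0)) }) D≤z)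
    , Sum.[ (λ q∣p → ℕ.<⇒≱ z<q (ℕ.≤-trans (ℕ.∣⇒≤ q∣p) p≤z)) , q∤W ]′ ∘ euclidsLemma p W q-prime ∘ ∣⇒∣ᵤ
    , Sum.[ (λ q∣j+p → ℕ.<⇒≱ z<q (ℕ.≤-trans (ℕ.∣⇒≤ q∣j+p) (ℕ.≤-trans (ℕ.+-monoˡ-≤ p j≤p) 2p≤z)))
          , q∤W ∘ prime∣^⇒∣ q-prime W (suc t)
          ]′ ∘ euclidsLemma (j ℕ.+ p) (W ℕ.^ suc t) q-prime ∘ ∣⇒∣ᵤ
    where
    z<q = prime∣norm⇒large s t q-prime q∣n
    q∤W = prime∣norm⇒∤W s t q-prime q∣n
    p≤z : p ≤ z
    p≤z = ℕ.≤-trans (ℕ.m≤m+n p p) 2p≤z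
    small : ∀ {k} → + q ∣ₛ k → k ≢ 0ℤ → ∣ k ∣ ≤ z → ⊥
    small q∣k k≢0 k≤z = ℕ.<⇒≱ z<q (prime∣∧≤⇒≤ q∣k k≢0 k≤z)

  2∣W : 2 ℕ.∣ W
  2∣W = multiple (ℕ.≤-trans (s≤s (s≤s z≤n)) 8≤z) (p≢2 ∘ prime∣prime⇒≡ p-prime prime[2])

  slopes : ∀ s s′ {t t′} → t < t′ → u s ℕ.* y t′ ≢ u s′ ℕ.* y t
  slopes s s′ {t} t<t′ eq with ℕ.m≤n⇒∃[o]m+o≡n t<t′
  ... | o , refl = prime∣W∤u prime[2] 2∣W s′ (subst (2 ℕ.∣_) uW≡u′
                     (ℕ.∣n⇒∣m*n (u s) (ℕ.∣m⇒∣m*n (W ℕ.^ o) 2∣W)))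
    where
    lemma : ∀ u k w wo W → u ℕ.* (W ℕ.* wo) ℕ.* (k ℕ.* w) ≡ u ℕ.* (k ℕ.* (W ℕ.* (w ℕ.* wo)))
    lemma = ℕR.solve-∀
    uW≡u′ : u s ℕ.* W ℕ.^ suc o ≡ u s′
    uW≡u′ = ℕ.*-cancelʳ-≡ _ _ (y t) {{y≢0 t}}
      (trans (lemma (u s) (j ℕ.+ p) (W ℕ.^ suc t) (W ℕ.^ o) W)
        (trans (cong (λ w → u s ℕ.* ((j ℕ.+ p) ℕ.* (W ℕ.* w))) (sym (ℕ.^-distribˡ-+-* W (suc t) o))) eq))

  squarefree-norm : ∀ X → ∃[ s ] ∃[ t ] X < ∣ norm D (u s) (y t) ∣ ×
                    (∀ {q} → Prime q → ¬ + (q ℕ.* q) ∣ₛ norm D (u s) (y t))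
  squarefree-norm X = SquarefreeNorms.exists D u₀ c z X y 8≤z generic slopes

∈⇒∣∣≤sum : ∀ {d xs} → d ∈ xs → ∣ d ∣ ≤ sum (map ∣_∣ xs)
∈⇒∣∣≤sum {xs = x ∷ xs} (here refl) = ℕ.m≤m+n ∣ x ∣ _
∈⇒∣∣≤sum {xs = x ∷ xs} (there d∈)  = ℕ.≤-trans (∈⇒∣∣≤sum d∈) (ℕ.m≤n+m _ ∣ x ∣)

infinite-squarefree-parts :
  ∀ a b c g → (∀ n → ℤ[x].coeff g n ≡ 0ℤ) → ∀ {p} → Prime p → p ≢ 2 →
  ¬ + p ∣ₛ a → ¬ + p ∣ₛ disc a b c → ∀ m → ¬ + p ∣ₛ m →
  Infinite (λ d → 𝒮 (c ∷ b ∷ a ∷ g) d × d ≡ m [mod p ])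
infinite-squarefree-parts a b c g g≡0 {p} p-prime p≢2 p∤a p∤D m p∤m xs =
  from-decomposition (squarefree-decomposition a a≢0)
  where
  D = disc a b c
  z = ∣ a ∣ ℕ.+ (∣ D ∣ ℕ.+ (p ℕ.+ p ℕ.+ 8))
  X = sum (map ∣_∣ xs)

  a≢0 : a ≢ 0ℤ
  a≢0 refl = p∤a (∣ᵤ⇒∣ (p ℕ.∣0))

  a≤z : ∣ a ∣ ≤ z
  a≤z = ℕ.m≤m+n ∣ a ∣ _
  D+r≤z : ∣ D ∣ ℕ.+ (p ℕ.+ p ℕ.+ 8) ≤ z
  D+r≤z = ℕ.m≤n+m _ ∣ a ∣
  r≤z : p ℕ.+ p ℕ.+ 8 ≤ z
  r≤z = ℕ.≤-trans (ℕ.m≤n+m _ ∣ D ∣) D+r≤z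

  Result : Set
  Result = ∃[ e ] (𝒮 (c ∷ b ∷ a ∷ g) e × e ≡ m [mod p ]) × ¬ (e ∈ xs)

  from-decomposition :
    (∃[ d ] ∃[ k ] a ≡ d ℤ.* (k ℤ.* k) × (∀ {q} → Prime q → ¬ + (q ℕ.* q) ∣ₛ d)) → Result
  from-decomposition (d , k , a≡dk² , d-sqf) =
    let i , j , j≤p , p∣dn-m = norm-represents p-prime p≢2 D d m p∤D p∤d
        w , p∤w , multiple   = coprime-common-multiple p-prime z
        W , w∣W , p∣W-1      = unit-multiple p-prime p∤w
    in  from-progression i j j≤p p∣dn-m W p∣W-1 (λ n≤z p∤n → ℕ.∣-trans (multiple n≤z p∤n) w∣W)
    where
    d∣a : d ∣ₛ a
    d∣a = subst (d ∣ₛ_) (sym a≡dk²) (∣m⇒∣m*n (k ℤ.* k) ∣-refl)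
    p∤d : ¬ + p ∣ₛ d
    p∤d p∣d = p∤a (∣-trans p∣d d∣a)
    d≢0 : d ≢ 0ℤ
    d≢0 refl = a≢0 a≡dk²

    from-progression : ∀ i j → j ≤ p → + p ∣ₛ d ℤ.* norm D i j ℤ.- m → ∀ W → + p ∣ₛ + W ℤ.- 1ℤ →
                       (∀ {n} → .{{NonZero n}} → n ≤ z → ¬ p ℕ.∣ n → n ℕ.∣ W) → Result
    from-progression i j j≤p p∣dn-m W p∣W-1 multiple =
      let s , t , X<∣E∣ , E-sqf = squarefree-norm X
          E = norm D (u s) (y t)
          ∣E∣>0 = ℕ.≤-<-trans z≤n X<∣E∣
          E≢0 = λ E≡0 → ℕ.<⇒≢ ∣E∣>0 (sym (cong ∣_∣ E≡0))
          dE-sqf = squarefree (d ℤ.* E) (*-≢0 d≢0 E≢0) λ {q} q-prime →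
            Sum.[ d-sqf q-prime , E-sqf q-prime ]′ ∘ prime-sq∣*⇒∣⊎∣ q-prime d E
              (λ (q∣d , q∣E) → ℕ.<⇒≱ (prime∣norm⇒large s t q-prime q∣E)
                 (prime∣∧≤⇒≤ (∣-trans q∣d d∣a) a≢0 a≤z))
          X<∣dE∣ = ℕ.<-≤-trans X<∣E∣ (subst (∣ E ∣ ≤_) (sym (ℤ.abs-* d E))
                     (ℕ.m≤n*m ∣ E ∣ ∣ d ∣ {{ℕ.≢-nonZero (d≢0 ∘ ℤ.∣i∣≡0⇒i≡0)}}))
      in  d ℤ.* E
          , ( norm∈𝒮 a b c g g≡0 (+ u s) (+ y t) d k
                (ℕ.≢-nonZero⁻¹ (y t) {{y≢0 t}} ∘ ℤ.+-injective) a≢0 a≡dk² E refl E≢0 dE-sqf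
            , ∣⇒∣ᵤ (dnorm≡m s t))
          , λ dE∈xs → ℕ.<⇒≱ X<∣dE∣ (∈⇒∣∣≤sum dE∈xs)
      where
      open Progression p-prime p≢2 D d m p∤D p∤d p∤m z
        (ℕ.≤-trans (ℕ.m≤n+m 8 (p ℕ.+ p)) r≤z)
        (ℕ.≤-trans (ℕ.m≤m+n (p ℕ.+ p) 8) r≤z)
        (ℕ.≤-trans (ℕ.m≤m+n ∣ D ∣ _) D+r≤z)
        i j j≤p p∣dn-m W p∣W-1 multiple
        using (u; y; y≢0; squarefree-norm; prime∣norm⇒large; dnorm≡m)

proposition3p5 : (f : ℤ[x].Poly) → ℤ[x].HasDegree f 2 → Separable f →
    (p : ℕ) → GoodQuadratic p f →
    (m : ℤ) → Coprime m (+ p) →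
    Infinite (λ d → 𝒮 f d × d ≡ m [mod p ])
proposition3p5 []                f-deg _ p good m m⊥p = contradiction refl (proj₁ f-deg)
proposition3p5 (_ ∷ [])          f-deg _ p good m m⊥p = contradiction refl (proj₁ f-deg)
proposition3p5 (_ ∷ _ ∷ [])      f-deg _ p good m m⊥p = contradiction refl (proj₁ f-deg)
proposition3p5 (c ∷ b ∷ a ∷ g)   f-deg _ p good m m⊥p =
  infinite-squarefree-parts a b c g (λ n → proj₂ f-deg (3 ℕ.+ n) (s≤s (s≤s (s≤s z≤n))))
    p-prime odd p∤a p∤D m p∤m
  where
  open GoodQuadratic good renaming (prime to p-prime)
  ∣⇒≡0 : ∀ {i} → + p ∣ₛ i → i ≡ 0ℤ [mod p ]
  ∣⇒≡0 {i} p∣i = ∣⇒∣ᵤ (subst (+ p ∣ₛ_) (sym (ℤ.+-identityʳ i)) p∣i)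
  p∤a : ¬ + p ∣ₛ a
  p∤a p∣a = proj₁ (sameDegree 2 f-deg) (∣⇒≡0 p∣a)
  lemma : ∀ a b c → b ℤ.* b ℤ.- + 4 ℤ.* (a ℤ.* c) ≡
          b ℤ.* b ℤ.+ ℤ.- (a ℤ.* c ℤ.+ (a ℤ.* c ℤ.+ (a ℤ.* c ℤ.+ (a ℤ.* c ℤ.+ 0ℤ))))
  lemma = ℤR.solve-∀
  p∤D : ¬ + p ∣ₛ disc a b c
  p∤D p∣D = discriminant (∣⇒≡0 (subst (+ p ∣ₛ_) (lemma a b c) p∣D))
  p∤m : ¬ + p ∣ₛ m
  p∤m p∣m = ¬prime[1] (subst Prime (m⊥p (∣⇒∣ᵤ p∣m , ℕ.∣-refl)) p-prime)
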